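{- Let $\Sigma$ be a finite set of node labels and $\bot\notin\Sigma$. For every FSLP $F$ over $\Sigma$ one can construct in linear time a TSLP $T$ over $\Sigma\cup\{\bot\}$ with $[\![T]\!]=\mathrm{fcns}([\![F]\!])$ and $|T|\in O(|F|)$.
   Context: **Trees and forests.** $\mathcal{F}_0(\Sigma)$ is the set of finite ordered $\Sigma$-labelled forests (possibly empty sequences of trees) and $\mathcal{T}_0(\Sigma)$ the set of ordered unranked $\Sigma$-labelled trees. Inductively: a sequence $t_1\cdots t_n$ ($n\ge 0$) of trees is a forest ($\varepsilon$ is the empty one), and $a(f)$ is a tree for $a\in\Sigma$ and $f$ a forest; $a()$ is also written $a$. Fix a parameter $x\notin\Sigma$. $\mathcal{F}_1(\Sigma)$ is the set of forests over $\Sigma\cup\{x\}$ in which $x$ occurs exactly once, at a leaf. $\mathcal{F}(\Sigma)=\mathcal{F}_0(\Sigma)\cup\mathcal{F}_1(\Sigma)$. **fcns-encoding.** $\mathrm{fcns}:\mathcal{F}_0(\Sigma)\to\mathcal{T}_0(\Sigma\uplus\{\bot\})$ is given by $\mathrm{fcns}(\varepsilon)=\bot$ and $\mathrm{fcns}(a(f)g)=a(\mathrm{fcns}(f)\,\mathrm{fcns}(g))$ for $a\in\Sigma$, $f,g\in\mathcal{F}_0(\Sigma)$. **FSLPs.** The forest algebra on $\mathcal{F}(\Sigma)$ has operations: horizontal concatenation $fg$ (defined if at least one of $f,g$ is in $\mathcal{F}_0(\Sigma)$); vertical concatenation $f\langle g\rangle$ (defined if $f\in\mathcal{F}_1(\Sigma)$;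 replace $x$ in $f$ by $g$); the unary operations $f\mapsto a(f)$, $a\in\Sigma$; the constants $\varepsilon$ and $x$. An FSLP over $\Sigma$ is $F=(V,S,\rho)$ with $V$ a finite set of variables, $S\in V$ the start variable, and $\rho$ mapping each $A\in V$ to its right-hand side, an expression over these operations in which variables from $V$ may occur as atoms, such that the relation "$B$ occurs in $\rho(A)$" is acyclic, all values $[\![A]\!]_F$ (obtained by evaluating $\rho(A)$ recursively) are defined, and $[\![F]\!]:=[\![S]\!]_F\in\mathcal{F}_0(\Sigma)$. The size $|F|$ is the total number of occurrences of operations (including constants) in all right-hand sides (this is the number of variables if every right-hand side is a single operation applied to variables). A TSLP is an FSLP in which every right-hand side has the form $a$, $a(BC)$, $a(xB)$, $a(Bx)$, or $B\langle C\rangle$ with $a$ a label and $B,C$ variables. -}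

module Defs where

open import Data.Bool using (if_then_else_; _∧_)
open import Data.Empty using (⊥)
open import Data.Fin using (Fin; toℕ)
open import Data.List using (List; []; _∷_; _++_; length; map; concatMap; allFin; applyUpTo)
open import Data.List.Membership.Propositional using (_∈_)
open import Data.Maybe using (Maybe; just; nothing)
open import Data.Nat using (ℕ; zero; suc; _+_; _≤_; _≡ᵇ_)
open import Data.Nat.ListAction using (sum)
open import Data.Product using (_×_; ∃-syntax; proj₁)
open import Data.Sum using (_⊎_)
open import Data.Unit using (⊤; tt)
open import Data.Vec using (Vec; []; _∷_; lookup) renaming (map to mapᵛ)
open import Relation.Binary.Construct.Closure.Transitive using (TransClosure)
open import Relation.Binary.PropositionalEquality using (_≡_; _≢_)
open import Relation.Nullary using (¬_)

-- Ordered unranked trees with nodes labelled in Σ; a leaf may instead carry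
-- a parameter from X, so that parameters occur at leaves only.
data Tree (Σ X : Set) : Set where
  node  : Σ → List (Tree Σ X) → Tree Σ X
  param : X → Tree Σ X

Tree₀ Forest₀ : Set → Set
Tree₀   Σ = Tree Σ ⊥
Forest₀ Σ = List (Tree₀ Σ)

-- Forests over Σ ∪ {x}, with any number of occurrences of x.
Forestₓ : Set → Set
Forestₓ Σ = List (Tree Σ ⊤)

#x : ∀ {Σ} → Forestₓ Σ → ℕ
#x []             = 0
#x (node a f ∷ g) = #x f + #x g
#x (param _ ∷ g)  = suc (#x g)

InF₀ InF₁ : ∀ {Σ} → Forestₓ Σ → Set
InF₀ f = #x f ≡ 0
InF₁ f = #x f ≡ 1

embed : ∀ {Σ} → Forest₀ Σ → Forestₓ Σ
embed []             = []
embed (node a f ∷ g) = node a (embed f) ∷ embed g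

infix 8 _⟪_⟫

_⟪_⟫ : ∀ {Σ} → Forestₓ Σ → Forestₓ Σ → Forestₓ Σ
[]             ⟪ g ⟫ = []
(node a f ∷ h) ⟪ g ⟫ = node a (f ⟪ g ⟫) ∷ h ⟪ g ⟫
(param _ ∷ h)  ⟪ g ⟫ = g ++ h ⟪ g ⟫

-- Σ ∪ {⊥} is Maybe Σ, the new label ⊥ being nothing.
fcns : ∀ {Σ} → Forest₀ Σ → Tree₀ (Maybe Σ)
fcns []             = node nothing []
fcns (node a f ∷ g) = node (just a) (fcns f ∷ fcns g ∷ [])

infixr 6 _·_
infix  8 _⟨_⟩

data Expr (Σ : Set) (n : ℕ) : Set where
  var   : Fin n → Expr Σ n
  ε x   : Expr Σ n
  lab   : Σ → Expr Σ n → Expr Σ n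
  _·_   : Expr Σ n → Expr Σ n → Expr Σ n
  _⟨_⟩  : Expr Σ n → Expr Σ n → Expr Σ n

vars : ∀ {Σ n} → Expr Σ n → List (Fin n)
vars (var A)     = A ∷ []
vars ε           = []
vars x           = []
vars (lab a e)   = vars e
vars (e₁ · e₂)   = vars e₁ ++ vars e₂
vars (e₁ ⟨ e₂ ⟩) = vars e₁ ++ vars e₂

#ops : ∀ {Σ n} → Expr Σ n → ℕ
#ops (var A)     = 0
#ops ε           = 1
#ops x           = 1
#ops (lab a e)   = suc (#ops e)
#ops (e₁ · e₂)   = suc (#ops e₁ + #ops e₂)
#ops (e₁ ⟨ e₂ ⟩) = suc (#ops e₁ + #ops e₂)

module _ {Σ : Set} {n : ℕ} (ρ : Fin n → Expr Σ n) where

  _↝_ : Fin n → Fin n → Set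
  A ↝ B = B ∈ vars (ρ A)

  infix 4 _⊢_⇓_

  -- Evaluation; a derivation exists only if every operation is defined.
  data _⊢_⇓_ : Expr Σ n → Forestₓ Σ → Set where
    var : ∀ {A f} → _⊢_⇓_ (ρ A) f → _⊢_⇓_ (var A) f
    ε   : _⊢_⇓_ ε []
    x   : _⊢_⇓_ x (param tt ∷ [])
    lab : ∀ {a e f} → _⊢_⇓_ e f → _⊢_⇓_ (lab a e) (node a f ∷ [])
    hor : ∀ {e₁ e₂ f g} → _⊢_⇓_ e₁ f → _⊢_⇓_ e₂ g →
          InF₀ f ⊎ InF₀ g → _⊢_⇓_ (e₁ · e₂) (f ++ g)
    ver : ∀ {e₁ e₂ f g} → _⊢_⇓_ e₁ f → _⊢_⇓_ e₂ g →
          InF₁ f → _⊢_⇓_ (e₁ ⟨ e₂ ⟩) (f ⟪ g ⟫)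

record FSLP (Σ : Set) : Set where
  field
    #vars   : ℕ
    start   : Fin #vars
    rhs     : Fin #vars → Expr Σ #vars
    acyclic : ∀ A → ¬ TransClosure (_↝_ rhs) A A
    defined : ∀ A → ∃[ f ] rhs ⊢ var A ⇓ f
    ground  : ∃[ f ] rhs ⊢ var start ⇓ embed f

  size : ℕ
  size = sum (map (λ A → #ops (rhs A)) (allFin #vars))

open FSLP public using (size)

⟦_⟧ : ∀ {Σ} → FSLP Σ → Forest₀ Σ
⟦ F ⟧ = proj₁ (FSLP.ground F)

data TSLPRhs {Σ : Set} {n : ℕ} : Expr Σ n → Set where
  leaf   : ∀ a → TSLPRhs (lab a ε)
  branch : ∀ a B C → TSLPRhs (lab a (var B · var C))
  xleft  : ∀ a B → TSLPRhs (lab a (x · var B))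
  xright : ∀ a B → TSLPRhs (lab a (var B · x))
  comp   : ∀ B C → TSLPRhs (var B ⟨ var C ⟩)

IsTSLP : ∀ {Σ} → FSLP Σ → Set
IsTSLP F = ∀ A → TSLPRhs (FSLP.rhs F A)

-- An FSLP as a sequence of machine words, given a numbering of the labels:
-- the number of variables, the start variable, and then the right-hand
-- sides in prefix notation.

encodeExpr : ∀ {Σ n} → (Σ → ℕ) → Expr Σ n → List ℕ
encodeExpr # (var A)     = 0 ∷ toℕ A ∷ []
encodeExpr # ε           = 1 ∷ []
encodeExpr # x           = 2 ∷ []
encodeExpr # (lab a e)   = 3 ∷ # a ∷ encodeExpr # e
encodeExpr # (e₁ · e₂)   = 4 ∷ encodeExpr # e₁ ++ encodeExpr # e₂
encodeExpr # (e₁ ⟨ e₂ ⟩) = 5 ∷ encodeExpr # e₁ ++ encodeExpr # e₂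

encode : ∀ {Σ} → (Σ → ℕ) → FSLP Σ → List ℕ
encode # F = #vars ∷ toℕ start ∷ concatMap (λ A → encodeExpr # (rhs A)) (allFin #vars)
  where open FSLP F

-- The numbering of Σ ∪ {⊥} that puts ⊥ first.
withBottom : {Σ : Set} → (Σ → ℕ) → Maybe Σ → ℕ
withBottom # nothing  = 0
withBottom # (just a) = suc (# a)

-- The machine underlying the running time is a unit-cost successor RAM whose memory is
-- divided into finitely many arrays, programmed by recursive procedures.
-- A program is a finite piece of syntax, every instruction costs one step,
-- and in t steps no word exceeds the largest word of the input and the program
-- by more than t, so that the unit-cost measure cannot be abused by computing
-- with very large numbers.

-- Straight-line code with branching, for procedures of the given arities.
-- Code arity n may refer to n local words; const, incr, read and call each
-- bind one further local word in the continuation, at index zero.  Arrays are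
-- named by numerals of the program, never by computed words.
data Code {m : ℕ} (arity : Fin m → ℕ) : ℕ → Set where
  ret   : ∀ {n} → Fin n → Code arity n
  const : ∀ {n} → ℕ → Code arity (suc n) → Code arity n
  incr  : ∀ {n} → Fin n → Code arity (suc n) → Code arity n
  read  : ∀ {n} → (array : ℕ) (index : Fin n) → Code arity (suc n) → Code arity n
  write : ∀ {n} → (array : ℕ) (index value : Fin n) → Code arity n → Code arity n
  ifEq  : ∀ {n} → Fin n → Fin n → (then else : Code arity n) → Code arity n
  call  : ∀ {n} (p : Fin m) → Vec (Fin n) (arity p) → Code arity (suc n) → Code arity n

record Program : Set where
  field
    #procs : ℕ
    arity  : Fin #procs → ℕ
    body   : (p : Fin #procs) → Code arity (arity p)
    main   : Code arity 0

-- Contents of array k at index i.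
Memory : Set
Memory = ℕ → ℕ → ℕ

_[_,_]≔_ : Memory → ℕ → ℕ → ℕ → Memory
(M [ k , i ]≔ v) k′ i′ = if (k ≡ᵇ k′) ∧ (i ≡ᵇ i′) then v else M k′ i′

contents : List ℕ → ℕ → ℕ
contents []       i       = 0
contents (w ∷ ws) zero    = w
contents (w ∷ ws) (suc i) = contents ws i

-- The input is stored in array 0; all other memory is zero.
load : List ℕ → Memory
load ws zero    = contents ws
load ws (suc k) = λ _ → 0

module _ (P : Program) where
  open Program P

  -- Run c η M t v M′: with local words η and memory M, the code c stops after
  -- exactly t steps, returning v and leaving the memory M′.
  data Run : ∀ {n} → Code arity n → Vec ℕ n → Memory → ℕ → ℕ → Memory → Set where
    ret   : ∀ {n} {η : Vec ℕ n} {M i} →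
            Run (ret i) η M 1 (lookup η i) M
    const : ∀ {n} {η : Vec ℕ n} {M w c t v M′} →
            Run c (w ∷ η) M t v M′ →
            Run (const w c) η M (suc t) v M′
    incr  : ∀ {n} {η : Vec ℕ n} {M i c t v M′} →
            Run c (suc (lookup η i) ∷ η) M t v M′ →
            Run (incr i c) η M (suc t) v M′
    read  : ∀ {n} {η : Vec ℕ n} {M k i c t v M′} →
            Run c (M k (lookup η i) ∷ η) M t v M′ →
            Run (read k i c) η M (suc t) v M′
    write : ∀ {n} {η : Vec ℕ n} {M k i j c t v M′} →
            Run c η (M [ k , lookup η i ]≔ lookup η j) t v M′ →
            Run (write k i j c) η M (suc t) v M′
    ifEq  : ∀ {n} {η : Vec ℕ n} {M i j c d t v M′} →
            lookup η i ≡ lookup η j →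
            Run c η M t v M′ →
            Run (ifEq i j c d) η M (suc t) v M′
    ifNeq : ∀ {n} {η : Vec ℕ n} {M i j c d t v M′} →
            lookup η i ≢ lookup η j →
            Run d η M t v M′ →
            Run (ifEq i j c d) η M (suc t) v M′
    call  : ∀ {n} {η : Vec ℕ n} {M p is c s w M′ t v M″} →
            Run (body p) (mapᵛ (lookup η) is) M s w M′ →
            Run c (w ∷ η) M′ t v M″ →
            Run (call p is c) η M (suc (s + t)) v M″

-- Within the given number of steps, P turns the input into the output, which
-- it leaves in array 1, returning its length.
_computes_from_within_ : Program → List ℕ → List ℕ → ℕ → Set
P computes out from inp within bound =
  ∃[ t ] ∃[ M ] t ≤ bound
              × Run P (Program.main P) [] (load inp) t (length out) M
              × applyUpTo (M 1) (length out) ≡ out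

{-# OPTIONS --safe #-}

-- For f ∈ F₀ the map fcns h ↦ fcns (f h) is a context ctx f, and horizontal concatenation becomes
-- composition of contexts.  An f ∈ F₁ is l t r with l, r ∈ F₀ and t either x or a tree a(f′), where
-- fcns (f′⟨g⟩) = p⟨ctx g⟨u⟩⟩ for a context p and a tree u.  These data, given by at most four
-- variables of the TSLP, can be computed for f⟨g⟩ from those for f and g with boundedly many new
-- variables, and the other operations are instances: a(f) = a(x)⟨f⟩ and f g = (f x)⟨g⟩ for f ∈ F₀.
-- A memoized depth-first traversal from the start variable does this in linear time.

module Submission where

open import Defs
open import Data.Bool using (if_then_else_)
open import Data.Fin using (Fin; zero; suc; #_; toℕ; fromℕ<)
open import Data.Fin.Patterns
open import Data.Fin.Properties using (toℕ-fromℕ<; toℕ-injective; toℕ<n)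
open import Data.List using (List; []; _∷_; _++_; length; map; lookup; tabulate; concat; concatMap;
                             allFin; applyUpTo)
open import Data.List.Membership.Propositional using (_∈_)
open import Data.List.Membership.Propositional.Properties using (∈-++⁺ˡ; ∈-++⁺ʳ)
open import Data.List.Properties
  using (++-assoc; ++-identityʳ; length-++; concatMap-++; map-++; map-∘; map-cong; map-tabulate;
         tabulate-lookup)
open import Data.List.Relation.Unary.Any using (here; there)
open import Data.Maybe using (Maybe; just; nothing)
open import Data.Nat
open import Data.Nat.ListAction using (sum)
open import Data.Nat.ListAction.Properties using (sum-++)
open import Data.Nat.Properties
open import Algebra.Properties.CommutativeSemigroup +-commutativeSemigroup
  using (x∙yz≈xz∙y; x∙yz≈y∙xz; x∙yz≈yx∙z; x∙yz≈z∙xy)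
open import Data.Nat.Tactic.RingSolver using (solve-∀)
open import Data.Product using (_×_; _,_; proj₁; proj₂; ∃-syntax)
open import Data.Sum using (_⊎_; inj₁; inj₂)
open import Data.Unit using (⊤; tt)
open import Data.Vec using (Vec; []; _∷_) renaming (lookup to lookupᵛ; map to mapᵛ)
open import Function using (_∘_; _$_)
open import Function.Bundles using (_↔_; Inverse)
open import Relation.Binary.Construct.Closure.ReflexiveTransitive using (Star; ε; _◅_)
open import Relation.Binary.Construct.Closure.Transitive using (TransClosure; [_]; _∷_)
open import Relation.Binary.PropositionalEquality
open import Relation.Nullary using (¬_; yes; no; contradiction)

-- Forests

-- A TSLP context has one parameter, whereas an open forest `f` calls for two: the encoding of
-- `f⟨g⟩` depends on `g` and on the siblings that follow. If `x` is a root of `f`, then `l`, `g` and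
-- `r` lie on one right spine and their contexts compose. If `x` lies below a root labelled `a`,
-- then `g` belongs to the left child of that node and the following siblings to its right child.
-- The label `a` is therefore withheld from the output until one child is fixed: the left one once
-- `g` is ground, giving `a(Bx)`, or the right one once the tree is absorbed into an outer stem,
-- giving `a(xB)`. No TSLP variable denotes `x` itself, so the identity context needs a code outside
-- the grammar. The size counts operations only, so an occurrence of a variable may cost no output,
-- and its translation must be paid for once, however often it occurs. Both are handled by
-- amortisation: every untranslated variable holds credit proportional to its right-hand side.

private variable
  Σ A : Set
  k : ℕ

#x-++ : (f g : Forestₓ Σ) → #x (f ++ g) ≡ #x f + #x g
#x-++ []             g = refl
#x-++ (node a f ∷ h) g = trans (cong (#x f +_) (#x-++ h g)) (sym (+-assoc (#x f) (#x h) (#x g)))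
#x-++ (param _ ∷ h)  g = cong suc (#x-++ h g)

#x-⟪⟫ : (f g : Forestₓ Σ) → #x (f ⟪ g ⟫) ≡ #x f * #x g
#x-⟪⟫ []             g = refl
#x-⟪⟫ (node a f ∷ h) g =
  trans (cong₂ _+_ (#x-⟪⟫ f g) (#x-⟪⟫ h g)) (sym (*-distribʳ-+ (#x g) (#x f) (#x h)))
#x-⟪⟫ (param _ ∷ h)  g = trans (#x-++ g (h ⟪ g ⟫)) (cong (#x g +_) (#x-⟪⟫ h g))

#x-embed : (f : Forest₀ Σ) → InF₀ (embed f)
#x-embed []             = refl
#x-embed (node a f ∷ g) = cong₂ _+_ (#x-embed f) (#x-embed g)

⟪⟫-InF₁ : (f g : Forestₓ Σ) → InF₁ f → InF₁ g → InF₁ (f ⟪ g ⟫)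
⟪⟫-InF₁ f g p q = trans (#x-⟪⟫ f g) (cong₂ _*_ p q)

⟪⟫-InF₀ : (f g : Forestₓ Σ) → InF₁ f → InF₀ g → InF₀ (f ⟪ g ⟫)
⟪⟫-InF₀ f g p q = trans (#x-⟪⟫ f g) (cong₂ _*_ p q)

⟪⟫-++ : (f g h : Forestₓ Σ) → (f ++ g) ⟪ h ⟫ ≡ f ⟪ h ⟫ ++ g ⟪ h ⟫
⟪⟫-++ []             g h = refl
⟪⟫-++ (node a f ∷ k) g h = cong (node a (f ⟪ h ⟫) ∷_) (⟪⟫-++ k g h)
⟪⟫-++ (param _ ∷ k)  g h = trans (cong (h ++_) (⟪⟫-++ k g h)) (sym (++-assoc h _ _))

⟪⟫-assoc : (f g h : Forestₓ Σ) → f ⟪ g ⟫ ⟪ h ⟫ ≡ f ⟪ g ⟪ h ⟫ ⟫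
⟪⟫-assoc []             g h = refl
⟪⟫-assoc (node a f ∷ k) g h = cong₂ (λ u v → node a u ∷ v) (⟪⟫-assoc f g h) (⟪⟫-assoc k g h)
⟪⟫-assoc (param _ ∷ k)  g h =
  trans (⟪⟫-++ g (k ⟪ g ⟫) h) (cong (g ⟪ h ⟫ ++_) (⟪⟫-assoc k g h))

⟪⟫-identityʳ : (f : Forestₓ Σ) → f ⟪ param tt ∷ [] ⟫ ≡ f
⟪⟫-identityʳ []             = refl
⟪⟫-identityʳ (node a f ∷ g) = cong₂ (λ u v → node a u ∷ v) (⟪⟫-identityʳ f) (⟪⟫-identityʳ g)
⟪⟫-identityʳ (param _ ∷ g)  = cong (param tt ∷_) (⟪⟫-identityʳ g)

⟪⟫-ground : (f g : Forestₓ Σ) → InF₀ f → f ⟪ g ⟫ ≡ f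
⟪⟫-ground []             g p = refl
⟪⟫-ground (node a f ∷ h) g p =
  cong₂ (λ u v → node a u ∷ v)
        (⟪⟫-ground f g (m+n≡0⇒m≡0 (#x f) p)) (⟪⟫-ground h g (m+n≡0⇒n≡0 (#x f) p))

embed-++ : (f g : Forest₀ Σ) → embed (f ++ g) ≡ embed f ++ embed g
embed-++ []             g = refl
embed-++ (node a f ∷ h) g = cong (node a (embed f) ∷_) (embed-++ h g)

-- `fcns` accepts only `Forest₀`, so substituting a ground forest is needed with a result in that
-- type.
plug : Forestₓ Σ → Forest₀ Σ → Forest₀ Σ
plug []             h = []
plug (node a f ∷ g) h = node a (plug f h) ∷ plug g h
plug (param _ ∷ g)  h = h ++ plug g h

embed-plug : (f : Forestₓ Σ) (h : Forest₀ Σ) → f ⟪ embed h ⟫ ≡ embed (plug f h)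
embed-plug []             h = refl
embed-plug (node a f ∷ g) h = cong₂ (λ u v → node a u ∷ v) (embed-plug f h) (embed-plug g h)
embed-plug (param _ ∷ g)  h =
  trans (cong (embed h ++_) (embed-plug g h)) (sym (embed-++ h (plug g h)))

plug-++ : (f g : Forestₓ Σ) (h : Forest₀ Σ) → plug (f ++ g) h ≡ plug f h ++ plug g h
plug-++ []             g h = refl
plug-++ (node a f ∷ k) g h = cong (node a (plug f h) ∷_) (plug-++ k g h)
plug-++ (param _ ∷ k)  g h = trans (cong (h ++_) (plug-++ k g h)) (sym (++-assoc h _ _))

plug-embed : (f h : Forest₀ Σ) → plug (embed f) h ≡ f
plug-embed []             h = refl
plug-embed (node a f ∷ g) h = cong₂ (λ u v → node a u ∷ v) (plug-embed f h) (plug-embed g h)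

plug-⟪⟫ : (f g : Forestₓ Σ) (h : Forest₀ Σ) → plug (f ⟪ g ⟫) h ≡ plug f (plug g h)
plug-⟪⟫ []             g h = refl
plug-⟪⟫ (node a f ∷ k) g h = cong₂ (λ u v → node a u ∷ v) (plug-⟪⟫ f g h) (plug-⟪⟫ k g h)
plug-⟪⟫ (param _ ∷ k)  g h =
  trans (plug-++ g (k ⟪ g ⟫) h) (cong (plug g h ++_) (plug-⟪⟫ k g h))

fcns₁ : Forest₀ Σ → Forestₓ (Maybe Σ)
fcns₁ f = embed (fcns f ∷ [])

-- The context that maps fcns h to fcns (f h).
ctx : Forest₀ Σ → Forestₓ (Maybe Σ)
ctx []             = param tt ∷ []
ctx (node a f ∷ g) = node (just a) (fcns₁ f ++ ctx g) ∷ []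

ctx-InF₁ : (f : Forest₀ Σ) → InF₁ (ctx f)
ctx-InF₁ []             = refl
ctx-InF₁ (node a f ∷ g)
  rewrite #x-++ (fcns₁ f) (ctx g) | #x-embed (fcns f ∷ []) | ctx-InF₁ g = refl

ctx-++ : (f g : Forest₀ Σ) → ctx f ⟪ ctx g ⟫ ≡ ctx (f ++ g)
ctx-++ []             g = ++-identityʳ (ctx g)
ctx-++ (node a f ∷ h) g = cong (λ u → node (just a) u ∷ [])
  (trans (⟪⟫-++ (fcns₁ f) (ctx h) (ctx g))
         (cong₂ _++_ (⟪⟫-ground (fcns₁ f) (ctx g) (#x-embed (fcns f ∷ []))) (ctx-++ h g)))

-- Filling the hole with `fcns []` ends the sibling list. This turns the context of the whole forest
-- into its encoding, and yields the stem equation of `a(x)` with the leaf ⊥ as `u`.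
ctx-⊥ : (f : Forest₀ Σ) → ctx f ⟪ node nothing [] ∷ [] ⟫ ≡ fcns₁ f
ctx-⊥ []             = refl
ctx-⊥ (node a f ∷ g) = cong (λ u → node (just a) u ∷ [])
  (trans (⟪⟫-++ (fcns₁ f) (ctx g) _)
         (trans (cong₂ _++_ (⟪⟫-ground (fcns₁ f) _ (#x-embed (fcns f ∷ []))) (ctx-⊥ g))
                (sym (embed-++ (fcns f ∷ []) (fcns g ∷ [])))))

⟪⟫-middle : ∀ (f : Forest₀ Σ) t (g : Forest₀ Σ) h →
            (embed f ++ t ++ embed g) ⟪ h ⟫ ≡ embed f ++ t ⟪ h ⟫ ++ embed g
⟪⟫-middle f t g h = begin
  (embed f ++ t ++ embed g) ⟪ h ⟫
    ≡⟨ ⟪⟫-++ (embed f) _ h ⟩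
  embed f ⟪ h ⟫ ++ (t ++ embed g) ⟪ h ⟫
    ≡⟨ cong₂ _++_ (⟪⟫-ground (embed f) h (#x-embed f)) (⟪⟫-++ t _ h) ⟩
  embed f ++ t ⟪ h ⟫ ++ embed g ⟪ h ⟫
    ≡⟨ cong (λ k → embed f ++ t ⟪ h ⟫ ++ k) (⟪⟫-ground (embed g) h (#x-embed g)) ⟩
  embed f ++ t ⟪ h ⟫ ++ embed g ∎
  where open ≡-Reasoning

embed-middle : ∀ (f g h : Forest₀ Σ) → embed ((f ++ g) ++ h) ≡ embed f ++ embed g ++ embed h
embed-middle f g h = trans (embed-++ (f ++ g) h)
  (trans (cong (_++ embed h) (embed-++ f g)) (++-assoc (embed f) _ _))

nest-middle : ∀ (f f′ : Forest₀ Σ) t (g′ g : Forest₀ Σ) →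
              embed (f ++ f′) ++ t ++ embed (g′ ++ g) ≡
              embed f ++ (embed f′ ++ t ++ embed g′) ++ embed g
nest-middle f f′ t g′ g = begin
  embed (f ++ f′) ++ t ++ embed (g′ ++ g)
    ≡⟨ cong₂ (λ u v → u ++ t ++ v) (embed-++ f f′) (embed-++ g′ g) ⟩
  (embed f ++ embed f′) ++ t ++ embed g′ ++ embed g
    ≡⟨ ++-assoc (embed f) _ _ ⟩
  embed f ++ embed f′ ++ t ++ embed g′ ++ embed g
    ≡⟨ cong (λ k → embed f ++ embed f′ ++ k) (++-assoc t _ _) ⟨
  embed f ++ embed f′ ++ (t ++ embed g′) ++ embed g
    ≡⟨ cong (embed f ++_) (++-assoc (embed f′) _ _) ⟨
  embed f ++ (embed f′ ++ t ++ embed g′) ++ embed g ∎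
  where open ≡-Reasoning

plug-middle : ∀ (f : Forest₀ Σ) t (g : Forest₀ Σ) h →
              plug (embed f ++ t ++ embed g) h ≡ f ++ plug t h ++ g
plug-middle f t g h = trans (plug-++ (embed f) _ h)
  (cong₂ _++_ (plug-embed f h) (trans (plug-++ t _ h) (cong (plug t h ++_) (plug-embed g h))))

-- The equation describing a stem a(f), after substituting for x a forest with x at a root or below
-- one.  The terms c and d are those computed by graftBody.

plug-flat : ∀ (f : Forestₓ Σ) c d → (∀ h → fcns₁ (plug f h) ≡ c ⟪ ctx h ⟪ d ⟫ ⟫) →
            ∀ l r h → fcns₁ (plug (f ⟪ embed l ++ param tt ∷ embed r ⟫) h) ≡
                      c ⟪ ctx l ⟫ ⟪ ctx h ⟪ ctx r ⟪ d ⟫ ⟫ ⟫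
plug-flat f c d eq l r h = begin
  fcns₁ (plug (f ⟪ embed l ++ param tt ∷ embed r ⟫) h)
    ≡⟨ cong fcns₁ (plug-⟪⟫ f _ h) ⟩
  fcns₁ (plug f (plug (embed l ++ param tt ∷ embed r) h))
    ≡⟨ eq _ ⟩
  c ⟪ ctx (plug (embed l ++ param tt ∷ embed r) h) ⟪ d ⟫ ⟫
    ≡⟨ cong (λ k → c ⟪ ctx k ⟪ d ⟫ ⟫) (plug-middle l (param tt ∷ []) r h) ⟩
  c ⟪ ctx (l ++ (h ++ []) ++ r) ⟪ d ⟫ ⟫
    ≡⟨ cong (λ k → c ⟪ ctx (l ++ k ++ r) ⟪ d ⟫ ⟫) (++-identityʳ h) ⟩
  c ⟪ ctx (l ++ h ++ r) ⟪ d ⟫ ⟫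
    ≡⟨ cong (λ k → c ⟪ k ⟪ d ⟫ ⟫)
            (trans (cong (ctx l ⟪_⟫) (ctx-++ h r)) (ctx-++ l (h ++ r))) ⟨
  c ⟪ ctx l ⟪ ctx h ⟪ ctx r ⟫ ⟫ ⟪ d ⟫ ⟫
    ≡⟨ cong (c ⟪_⟫) (trans (⟪⟫-assoc (ctx l) _ d) (cong (ctx l ⟪_⟫) (⟪⟫-assoc (ctx h) _ d))) ⟩
  c ⟪ ctx l ⟪ ctx h ⟪ ctx r ⟪ d ⟫ ⟫ ⟫ ⟫
    ≡⟨ ⟪⟫-assoc c (ctx l) _ ⟨
  c ⟪ ctx l ⟫ ⟪ ctx h ⟪ ctx r ⟪ d ⟫ ⟫ ⟫ ∎
  where open ≡-Reasoning

plug-nested : ∀ (f : Forestₓ Σ) c d → (∀ h → fcns₁ (plug f h) ≡ c ⟪ ctx h ⟪ d ⟫ ⟫) → InF₀ d →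
              ∀ b (f′ : Forestₓ Σ) c′ d′ → (∀ h → fcns₁ (plug f′ h) ≡ c′ ⟪ ctx h ⟪ d′ ⟫ ⟫) →
              ∀ l r h →
              fcns₁ (plug (f ⟪ embed l ++ node b f′ ∷ embed r ⟫) h) ≡
              c ⟪ ctx l ⟫ ⟪ node (just b) (param tt ∷ ctx r ⟪ d ⟫) ∷ [] ⟫ ⟪ c′ ⟫ ⟪ ctx h ⟪ d′ ⟫ ⟫
plug-nested f c d eq d₀ b f′ c′ d′ eq′ l r h = begin
  fcns₁ (plug (f ⟪ embed l ++ node b f′ ∷ embed r ⟫) h)
    ≡⟨ cong fcns₁ (plug-⟪⟫ f _ h) ⟩
  fcns₁ (plug f (plug (embed l ++ node b f′ ∷ embed r) h))
    ≡⟨ eq _ ⟩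
  c ⟪ ctx (plug (embed l ++ node b f′ ∷ embed r) h) ⟪ d ⟫ ⟫
    ≡⟨ cong (λ k → c ⟪ ctx k ⟪ d ⟫ ⟫) (plug-middle l (node b f′ ∷ []) r h) ⟩
  c ⟪ ctx (l ++ node b h′ ∷ r) ⟪ d ⟫ ⟫
    ≡⟨ cong (λ k → c ⟪ k ⟪ d ⟫ ⟫) (ctx-++ l (node b h′ ∷ r)) ⟨
  c ⟪ ctx l ⟪ ctx (node b h′ ∷ r) ⟫ ⟪ d ⟫ ⟫
    ≡⟨ cong (c ⟪_⟫) (⟪⟫-assoc (ctx l) _ d) ⟩
  c ⟪ ctx l ⟪ ctx (node b h′ ∷ r) ⟪ d ⟫ ⟫ ⟫
    ≡⟨ ⟪⟫-assoc c (ctx l) _ ⟨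
  c ⟪ ctx l ⟫ ⟪ node (just b) ((fcns₁ h′ ++ ctx r) ⟪ d ⟫) ∷ [] ⟫
    -- As `d`, and hence `ctx r ⟪ d ⟫`, is ground, the left child `fcns₁ h′` can be pulled out of
    -- the node, leaving the one-parameter context denoted by `left b`.
    ≡⟨ cong (λ u → c ⟪ ctx l ⟫ ⟪ node (just b) u ∷ [] ⟫)
            (trans (⟪⟫-++ (fcns₁ h′) (ctx r) d)
                   (cong₂ _++_ (⟪⟫-ground (fcns₁ h′) d (#x-embed (fcns h′ ∷ [])))
                               (sym (⟪⟫-ground (ctx r ⟪ d ⟫) (fcns₁ h′)
                                               (⟪⟫-InF₀ (ctx r) d (ctx-InF₁ r) d₀))))) ⟩
  c ⟪ ctx l ⟫ ⟪ (node (just b) (param tt ∷ ctx r ⟪ d ⟫) ∷ []) ⟪ fcns₁ h′ ⟫ ⟫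
    ≡⟨ ⟪⟫-assoc (c ⟪ ctx l ⟫) _ (fcns₁ h′) ⟨
  c ⟪ ctx l ⟫ ⟪ node (just b) (param tt ∷ ctx r ⟪ d ⟫) ∷ [] ⟫ ⟪ fcns₁ h′ ⟫
    ≡⟨ cong (c ⟪ ctx l ⟫ ⟪ _ ⟫ ⟪_⟫) (eq′ h) ⟩
  c ⟪ ctx l ⟫ ⟪ node (just b) (param tt ∷ ctx r ⟪ d ⟫) ∷ [] ⟫ ⟪ c′ ⟪ ctx h ⟪ d′ ⟫ ⟫ ⟫
    ≡⟨ ⟪⟫-assoc (c ⟪ ctx l ⟫ ⟪ _ ⟫) c′ _ ⟨
  c ⟪ ctx l ⟫ ⟪ node (just b) (param tt ∷ ctx r ⟪ d ⟫) ∷ [] ⟫ ⟪ c′ ⟫ ⟪ ctx h ⟪ d′ ⟫ ⟫ ∎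
  where
  open ≡-Reasoning
  h′ = plug f′ h

-- Output grammars as lists of instructions

-- References are plain numbers rather than elements of `Fin n`, so that an instruction keeps its
-- meaning while the list grows. A node with two ground children arises as the `comp` of a one-sided
-- context with a tree.
data Ins (Σ : Set) : Set where
  bot        : Ins Σ
  left right : Σ → ℕ → Ins Σ
  comp       : ℕ → ℕ → Ins Σ

infix 4 _[_]=_

data _[_]=_ {A : Set} : List A → ℕ → A → Set where
  here  : ∀ {x xs} → x ∷ xs [ zero ]= x
  there : ∀ {x y xs k} → xs [ k ]= y → x ∷ xs [ suc k ]= y

[]=-++ : {x : A} {xs : List A} (ys : List A) → xs [ k ]= x → xs ++ ys [ k ]= x
[]=-++ ys here      = here
[]=-++ ys (there p) = there ([]=-++ ys p)

[]=-last : {x : A} (xs : List A) → xs ++ x ∷ [] [ length xs ]= x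
[]=-last []       = here
[]=-last (_ ∷ xs) = there ([]=-last xs)

[]=-< : {x : A} {xs : List A} → xs [ k ]= x → k < length xs
[]=-< here      = s≤s z≤n
[]=-< (there p) = s≤s ([]=-< p)

[]=-lookup : {x : A} (xs : List A) (i : Fin (length xs)) → xs [ toℕ i ]= x → lookup xs i ≡ x
[]=-lookup (_ ∷ xs) zero    here      = refl
[]=-lookup (_ ∷ xs) (suc i) (there p) = []=-lookup xs i p

-- The conditions `j < k` and `i < k` make references point backwards, which gives acyclicity of the
-- grammar.
data Val {Σ : Set} (is : List (Ins Σ)) : ℕ → Forestₓ (Maybe Σ) → Set where
  bot   : ∀ {k} → is [ k ]= bot → Val is k (node nothing [] ∷ [])
  left  : ∀ {k a j f} → is [ k ]= left a j → j < k → Val is j f → InF₀ f →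
          Val is k (node (just a) (param tt ∷ f) ∷ [])
  right : ∀ {k a j f} → is [ k ]= right a j → j < k → Val is j f → InF₀ f →
          Val is k (node (just a) (f ++ param tt ∷ []) ∷ [])
  comp  : ∀ {k i j f g} → is [ k ]= comp i j → i < k → j < k →
          Val is i f → Val is j g → InF₁ f → Val is k (f ⟪ g ⟫)

Val-++ : ∀ {is : List (Ins Σ)} {f} js → Val is k f → Val (is ++ js) k f
Val-++ js (bot p)               = bot ([]=-++ js p)
Val-++ js (left p j<k v c)      = left ([]=-++ js p) j<k (Val-++ js v) c
Val-++ js (right p j<k v c)     = right ([]=-++ js p) j<k (Val-++ js v) c
Val-++ js (comp p i<k j<k v w c) = comp ([]=-++ js p) i<k j<k (Val-++ js v) (Val-++ js w) c

Val-< : ∀ {is : List (Ins Σ)} {f} → Val is k f → k < length is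
Val-< (bot p)            = []=-< p
Val-< (left p _ _ _)     = []=-< p
Val-< (right p _ _ _)    = []=-< p
Val-< (comp p _ _ _ _ _) = []=-< p

WellFormed : List (Ins Σ) → Set
WellFormed is = ∀ k → k < length is → ∃[ f ] Val is k f

encodeIns : (Σ → ℕ) → Ins Σ → List ℕ
encodeIns num bot         = 3 ∷ 0 ∷ 1 ∷ []
encodeIns num (left a j)  = 3 ∷ suc (num a) ∷ 4 ∷ 2 ∷ 0 ∷ j ∷ []
encodeIns num (right a j) = 3 ∷ suc (num a) ∷ 4 ∷ 0 ∷ j ∷ 2 ∷ []
encodeIns num (comp i j)  = 5 ∷ 0 ∷ i ∷ 0 ∷ j ∷ []

cost : Ins Σ → ℕ
cost bot         = 2
cost (left _ _)  = 3
cost (right _ _) = 3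
cost (comp _ _)  = 1

code : (Σ → ℕ) → List (Ins Σ) → List ℕ
code num = concatMap (encodeIns num)

-- References beyond the end, which well-formed lists do not contain, become self-references.
ref : ∀ {n} → Fin n → ℕ → Fin n
ref {n} A j with j <? n
... | yes j<n = fromℕ< j<n
... | no  _   = A

toℕ-ref : ∀ {n} (A : Fin n) {j} → j < n → toℕ (ref A j) ≡ j
toℕ-ref {n} A {j} j<n with j <? n
... | yes p = toℕ-fromℕ< p
... | no ¬p = contradiction j<n ¬p

expr : ∀ {n} → Fin n → Ins Σ → Expr (Maybe Σ) n
expr A bot         = lab nothing ε
expr A (left a j)  = lab (just a) (x · var (ref A j))
expr A (right a j) = lab (just a) (var (ref A j) · x)
expr A (comp i j)  = var (ref A i) ⟨ var (ref A j) ⟩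

#ops-expr : ∀ {n} (A : Fin n) (i : Ins Σ) → #ops (expr A i) ≡ cost i
#ops-expr A bot         = refl
#ops-expr A (left _ _)  = refl
#ops-expr A (right _ _) = refl
#ops-expr A (comp _ _)  = refl

expr-TSLP : ∀ {n} (A : Fin n) (i : Ins Σ) → TSLPRhs (expr A i)
expr-TSLP A bot         = leaf nothing
expr-TSLP A (left a j)  = xleft (just a) _
expr-TSLP A (right a j) = xright (just a) _
expr-TSLP A (comp i j)  = comp _ _

module _ {Σ : Set} (is : List (Ins Σ)) (wf : WellFormed is) where

  private
    n = length is

  rules : Fin n → Expr (Maybe Σ) n
  rules A = expr A (lookup is A)

  private
    rule : ∀ A {i} → is [ toℕ A ]= i → rules A ≡ expr A i
    rule A p = cong (expr A) ([]=-lookup is A p)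

    val : ∀ A → ∃[ f ] Val is (toℕ A) f
    val A = wf (toℕ A) (toℕ<n A)

    -- The equation separates the number that `Val` recurses on from the index `A`, because
    -- `toℕ (ref A k) ≡ k` holds only propositionally.
    derive : ∀ A {k f} → k ≡ toℕ A → Val is k f → rules ⊢ var A ⇓ f
    derive-ref : ∀ A {k f} → Val is k f → rules ⊢ var (ref A k) ⇓ f
    derive-ref A v = derive (ref A _) (sym (toℕ-ref A (Val-< v))) v
    derive A refl (bot p) = var (subst (rules ⊢_⇓ _) (sym (rule A p)) (lab ε))
    derive A refl (left p _ v c) =
      var (subst (rules ⊢_⇓ _) (sym (rule A p)) (lab (hor x (derive-ref A v) (inj₂ c))))
    derive A refl (right p _ v c) =
      var (subst (rules ⊢_⇓ _) (sym (rule A p)) (lab (hor (derive-ref A v) x (inj₁ c))))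
    derive A refl (comp p _ _ v w c) =
      var (subst (rules ⊢_⇓ _) (sym (rule A p)) (ver (derive-ref A v) (derive-ref A w) c))

    descends : ∀ A B → _↝_ rules A B → toℕ B < toℕ A
    descends A B q with val A
    ... | _ , bot p with subst (λ e → B ∈ vars e) (rule A p) q
    ... | ()
    descends A B q | _ , left p j<k v _ with subst (λ e → B ∈ vars e) (rule A p) q
    ... | here refl = subst (_< _) (sym (toℕ-ref A (Val-< v))) j<k
    descends A B q | _ , right p j<k v _ with subst (λ e → B ∈ vars e) (rule A p) q
    ... | here refl = subst (_< _) (sym (toℕ-ref A (Val-< v))) j<k
    descends A B q | _ , comp p i<k j<k v w _ with subst (λ e → B ∈ vars e) (rule A p) q
    ... | here refl         = subst (_< _) (sym (toℕ-ref A (Val-< v))) i<k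
    ... | there (here refl) = subst (_< _) (sym (toℕ-ref A (Val-< w))) j<k

    descends⁺ : ∀ {A B} → TransClosure (_↝_ rules) A B → toℕ B < toℕ A
    descends⁺ [ p ]   = descends _ _ p
    descends⁺ (p ∷ q) = <-trans (descends⁺ q) (descends _ _ p)

  grammar : ∀ {s f} → Val is s (embed f) → FSLP (Maybe Σ)
  grammar {s} {f} v = record
    { #vars   = n
    ; start   = fromℕ< (Val-< v)
    ; rhs     = rules
    ; acyclic = λ A p → <-irrefl refl (descends⁺ p)
    ; defined = λ A → let g , w = val A in g , derive A refl w
    ; ground  = f , derive _ (sym (toℕ-fromℕ< (Val-< v))) v
    }

  rules-TSLP : ∀ A → TSLPRhs (rules A)
  rules-TSLP A = expr-TSLP A (lookup is A)

  private
    map-lookup : ∀ {B : Set} (f : Ins Σ → B) → map (f ∘ lookup is) (allFin n) ≡ map f is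
    map-lookup f = trans (map-∘ (allFin n))
      (cong (map f) (trans (map-tabulate (λ i → i) (lookup is)) (tabulate-lookup is)))

  sum-#ops-rules : sum (map (λ A → #ops (rules A)) (allFin n)) ≡ sum (map cost is)
  sum-#ops-rules = cong sum
    (trans (map-cong (λ A → #ops-expr A (lookup is A)) (allFin n)) (map-lookup cost))

  module _ (num : Σ → ℕ) where

    private
      encode-ref : ∀ A {k f} → Val is k f → toℕ (ref A k) ≡ k
      encode-ref A v = toℕ-ref A (Val-< v)

      encode-rule : ∀ A → encodeExpr (withBottom num) (rules A) ≡ encodeIns num (lookup is A)
      encode-rule A with val A
      ... | _ , bot p rewrite []=-lookup is A p = refl
      ... | _ , left p _ v _ rewrite []=-lookup is A p | encode-ref A v = refl
      ... | _ , right p _ v _ rewrite []=-lookup is A p | encode-ref A v = refl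
      ... | _ , comp p _ _ v w _ rewrite []=-lookup is A p | encode-ref A v | encode-ref A w = refl

    encode-rules : concatMap (encodeExpr (withBottom num) ∘ rules) (allFin n) ≡ code num is
    encode-rules = cong concat
      (trans (map-cong encode-rule (allFin n)) (map-lookup (encodeIns num)))

-- Sums

total : ∀ {n} → (Fin n → ℕ) → ℕ
total {n} f = sum (map f (allFin n))

map-suc : ∀ {A : Set} {n} (f : Fin (suc n) → A) → map f (tabulate suc) ≡ map (f ∘ suc) (allFin n)
map-suc f = trans (map-tabulate suc f) (sym (map-tabulate (λ i → i) (f ∘ suc)))

total-suc : ∀ {n} (f : Fin (suc n) → ℕ) → total f ≡ f zero + total (f ∘ suc)
total-suc f = cong (λ xs → f zero + sum xs) (map-suc f)

total-cong : ∀ {n} {f g : Fin n → ℕ} → (∀ i → f i ≡ g i) → total f ≡ total g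
total-cong {zero} eq = refl
total-cong {suc n} {f} {g} eq
  rewrite total-suc f | total-suc g = cong₂ _+_ (eq zero) (total-cong (eq ∘ suc))

total-mono : ∀ {n} {f g : Fin n → ℕ} → (∀ i → f i ≤ g i) → total f ≤ total g
total-mono {zero} le = ≤-refl
total-mono {suc n} {f} {g} le
  rewrite total-suc f | total-suc g = +-mono-≤ (le zero) (total-mono (le ∘ suc))

total-* : ∀ {n} c (f : Fin n → ℕ) → total (λ i → c * f i) ≡ c * total f
total-* {zero}  c f = sym (*-zeroʳ c)
total-* {suc n} c f rewrite total-suc (λ i → c * f i) | total-suc f | total-* c (f ∘ suc) =
  sym (*-distribˡ-+ c (f zero) _)

term≤total : ∀ {n} (f : Fin n → ℕ) i → f i ≤ total f
term≤total f zero rewrite total-suc f = m≤m+n _ _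
term≤total f (suc i) rewrite total-suc f = ≤-trans (term≤total (f ∘ suc) i) (m≤n+m _ _)

-- With `a` the weight of a variable, this is the drop in potential when its translation is
-- recorded.
total-update : ∀ {n} {f g : Fin n → ℕ} {a} i → f i ≡ a + g i → (∀ j → i ≢ j → f j ≡ g j) →
               total f ≡ a + total g
total-update {f = f} {g} {a} zero eq eqs rewrite total-suc f | total-suc g =
  trans (cong₂ _+_ eq (total-cong (λ j → eqs (suc j) λ ()))) (+-assoc a _ _)
total-update {f = f} {g} {a} (suc i) eq eqs rewrite total-suc f | total-suc g =
  trans (cong₂ _+_ (eqs zero λ ())
                   (total-update {g = g ∘ suc} i eq (λ j i≢j → eqs (suc j) λ { refl → i≢j refl })))
        (trans (sym (+-assoc (g zero) a _)) (trans (cong (_+ total (g ∘ suc)) (+-comm (g zero) a)) (+-assoc a _ _)))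

concatMap-suc : ∀ {A : Set} {n} (f : Fin (suc n) → List A) →
                concatMap f (allFin (suc n)) ≡ f zero ++ concatMap (f ∘ suc) (allFin n)
concatMap-suc f = cong (λ xs → f zero ++ concat xs) (map-suc f)

length-concatMap : ∀ {A : Set} {n} (f : Fin n → List A) →
                   length (concatMap f (allFin n)) ≡ total (length ∘ f)
length-concatMap {n = zero} f = refl
length-concatMap {n = suc n} f rewrite concatMap-suc f | total-suc (length ∘ f) =
  trans (length-++ (f zero)) (cong (length (f zero) +_) (length-concatMap (f ∘ suc)))

-- The program

-- Memory layout:
--   0      input
--   1      output; its first two words are written last
--   2, 3   at index 0: the next free output position, the number of output variables
--   4      at index 0: the position after the expression translated last
--   5, 6   by variable: the position of its right-hand side, its translation (0 if missing)
--   7      at index 0: the number of heap cells in use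
--   8–10   the three fields of the heap cells

pattern skip      = 0F
pattern locate    = 1F
pattern put       = 2F
pattern emitLeft  = 3F
pattern emitRight = 4F
pattern emitComp  = 5F
pattern compose   = 6F
pattern apply     = 7F
pattern alloc     = 8F
pattern graft     = 9F
pattern translate = Fin.suc 9F

arity : Fin 11 → ℕ
arity skip      = 1
arity locate    = 3
arity put       = 1
arity emitLeft  = 2
arity emitRight = 2
arity emitComp  = 2
arity compose   = 2
arity apply     = 2
arity alloc     = 3
arity graft     = 2
arity translate = 1

infixr 0 _▸_

-- Pure notation: the continuation of an instruction, for `ifEq` the else branch, is written after
-- it.
_▸_ : ∀ {m n} → (Code arity m → Code arity n) → Code arity m → Code arity n
f ▸ c = f c

-- The comments show the local words, newest first.

skipBody : Code arity 1
skipBody =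
  read 0 0F ▸ incr 1F ▸ const 0 ▸ ifEq 2F 0F           -- 0 p+1 w p
    (incr 1F ▸ ret 0F) ▸
  const 1 ▸ ifEq 3F 0F
    (ret 2F) ▸
  const 2 ▸ ifEq 4F 0F
    (ret 3F) ▸
  const 3 ▸ ifEq 5F 0F                                 -- 3 2 1 0 p+1 w p
    (incr 4F ▸ call skip (0F ∷ []) ▸ ret 0F) ▸
  call skip (4F ∷ []) ▸ call skip (0F ∷ []) ▸ ret 0F

-- Right-hand sides carry no length, so finding the next one requires parsing. Doing this once for
-- all variables lets `translate` jump to any right-hand side in one step.
locateBody : Code arity 3
locateBody =                                           -- a n p
  ifEq 0F 1F (ret 2F) ▸
  write 5 0F 2F ▸ incr 0F ▸ call skip (3F ∷ []) ▸      -- q a+1 a n p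
  call locate (1F ∷ 3F ∷ 0F ∷ []) ▸ ret 0F

putBody : Code arity 1
putBody = const 0 ▸ read 2 0F ▸ write 1 0F 2F ▸ incr 0F ▸ write 2 2F 0F ▸ ret 0F

finish : ∀ {n} → Code arity n
finish = const 0 ▸ read 3 0F ▸ incr 0F ▸ write 3 2F 0F ▸ ret 1F

emitLeftBody : Code arity 2
emitLeftBody =                                         -- a t
  const 3 ▸ call put (0F ∷ []) ▸                       -- _ 3 a t
  call put (2F ∷ []) ▸                                 -- _ _ 3 a t
  const 4 ▸ call put (0F ∷ []) ▸                       -- _ 4 _ _ 3 a t
  const 2 ▸ call put (0F ∷ []) ▸                       -- _ 2 _ 4 _ _ 3 a t
  const 0 ▸ call put (0F ∷ []) ▸                       -- _ 0 _ 2 _ 4 _ _ 3 a t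
  call put (# 10 ∷ []) finish

emitRightBody : Code arity 2
emitRightBody =                                        -- a t
  const 3 ▸ call put (0F ∷ []) ▸                       -- _ 3 a t
  call put (2F ∷ []) ▸                                 -- _ _ 3 a t
  const 4 ▸ call put (0F ∷ []) ▸                       -- _ 4 _ _ 3 a t
  const 0 ▸ call put (0F ∷ []) ▸                       -- _ 0 _ 4 _ _ 3 a t
  call put (8F ∷ []) ▸                                 -- _ _ 0 _ 4 _ _ 3 a t
  const 2 ▸ call put (0F ∷ []) finish

emitCompBody : Code arity 2
emitCompBody =                                         -- p q
  const 5 ▸ call put (0F ∷ []) ▸                       -- _ 5 p q
  const 0 ▸ call put (0F ∷ []) ▸                       -- _ 0 _ 5 p q
  call put (4F ∷ []) ▸                                 -- _ _ 0 _ 5 p q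
  call put (2F ∷ []) ▸                                 -- _ _ _ 0 _ 5 p q
  call put (7F ∷ []) finish

composeBody : Code arity 2
composeBody =                                          -- p q
  const 0 ▸ ifEq 1F 0F (ret 2F) ▸ ifEq 2F 0F (ret 1F) ▸
  call emitComp (1F ∷ 2F ∷ []) ▸ ret 0F

applyBody : Code arity 2
applyBody =                                            -- p t
  const 0 ▸ ifEq 1F 0F (ret 2F) ▸
  call emitComp (1F ∷ 2F ∷ []) ▸ ret 0F

allocBody : Code arity 3
allocBody =                                            -- u v w
  const 0 ▸ read 7 0F ▸                                -- i 0 u v w
  write 8 0F 2F ▸ write 9 0F 3F ▸ write 10 0F 4F ▸
  incr 0F ▸ write 7 2F 0F ▸ ret 1F

-- The translation of f⟨g⟩, from the cells (m₁, l₁, r₁) of f and (m₂, l₂, r₂) of g.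
graftBody : Code arity 2
graftBody =
  read 8 0F ▸ read 9 1F ▸ read 10 2F ▸ read 8 4F ▸ read 9 5F ▸ read 10 6F ▸
  const 0 ▸ const 1 ▸
  ifEq 7F 0F                                           -- 1 0 r₂ l₂ m₂ r₁ l₁ m₁ …
    (call compose (6F ∷ 3F ∷ []) ▸                     -- l 1 0 r₂ l₂ m₂ r₁ l₁ m₁ …
     ifEq 5F 2F
       (call compose (0F ∷ 6F ∷ []) ▸                  -- l′ l 1 0 …
        call alloc (3F ∷ 0F ∷ 3F ∷ []) ▸ ret 0F) ▸
     call compose (3F ∷ 6F ∷ []) ▸                     -- r l 1 0 r₂ l₂ m₂ r₁ l₁ m₁ …
     call alloc (6F ∷ 1F ∷ 0F ∷ []) ▸ ret 0F) ▸
  read 8 7F ▸ read 9 8F ▸ read 10 9F ▸                 -- t₁ p₁ a₁ 1 0 r₂ l₂ m₂ r₁ l₁ m₁ …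
  call compose (1F ∷ 6F ∷ []) ▸                        -- p t₁ p₁ a₁ 1 0 r₂ l₂ m₂ r₁ l₁ m₁ …
  ifEq 8F 5F
    (call apply (0F ∷ 1F ∷ []) ▸                       -- t p t₁ p₁ a₁ 1 0 r₂ l₂ m₂ r₁ l₁ m₁ …
     -- With `g` ground, the left child of `a₁` is the finished tree `t`; the following siblings go
     -- into the hole on the right.
     call emitRight (4F ∷ 0F ∷ []) ▸
     call compose (# 12 ∷ 0F ∷ []) ▸
     call compose (0F ∷ # 12 ∷ []) ▸                   -- l′ l u t p t₁ p₁ a₁ 1 0 …
     call alloc (9F ∷ 0F ∷ 9F ∷ []) ▸ ret 0F) ▸
  call apply (6F ∷ 1F ∷ []) ▸                          -- t p t₁ p₁ a₁ 1 0 r₂ l₂ m₂ r₁ l₁ m₁ …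
  ifEq 9F 5F
    (call alloc (4F ∷ 1F ∷ 0F ∷ []) ▸
     call alloc (0F ∷ # 12 ∷ # 11 ∷ []) ▸ ret 0F) ▸
  read 8 9F ▸ read 9 (# 10) ▸ read 10 (# 11) ▸         -- t₂ p₂ a₂ t p t₁ p₁ a₁ 1 0 …
  call emitLeft (2F ∷ 3F ∷ []) ▸                       -- u t₂ p₂ a₂ t p t₁ p₁ a₁ 1 0 …
  -- In `u` the inner label `a₂` has received its right child `t`, which encodes the siblings after
  -- it. The outer label `a₁` stays withheld.
  call compose (5F ∷ 0F ∷ []) ▸
  call compose (0F ∷ 3F ∷ []) ▸                        -- p″ p′ u t₂ p₂ a₂ t p t₁ p₁ a₁ 1 0 …
  call alloc (# 10 ∷ 0F ∷ 3F ∷ []) ▸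
  call alloc (0F ∷ # 18 ∷ # 17 ∷ []) ▸ ret 0F

joinCode : Code arity 12
joinCode =                                             -- 4 q₂ r₂ q₁ r₁ 3 2 1 0 p+1 w p
  read 8 4F ▸ ifEq 0F 9F                               -- m₁ 4 q₂ r₂ q₁ r₁ 3 2 1 0 …
    (read 9 5F ▸                                       -- l₁ m₁ 4 q₂ r₂ q₁ r₁ 3 2 1 0 …
     call alloc (9F ∷ 0F ∷ # 10 ∷ []) ▸
     call graft (0F ∷ 5F ∷ []) ▸                       -- v f l₁ m₁ 4 q₂ r₂ q₁ r₁ 3 2 1 0 …
     write 4 (# 12) 5F ▸ ret 0F) ▸
  read 9 3F ▸                                          -- l₂ m₁ 4 q₂ r₂ q₁ r₁ 3 2 1 0 …
  -- Here `f` contains `x`, so `g` is ground and the forest is `(x g)⟨f⟩`.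
  call alloc (9F ∷ # 10 ∷ 0F ∷ []) ▸
  call graft (0F ∷ 7F ∷ []) ▸                          -- v f l₂ m₁ 4 q₂ r₂ q₁ r₁ 3 2 1 0 …
  write 4 (# 12) 5F ▸ ret 0F

translateBody : Code arity 1
translateBody =
  read 0 0F ▸ incr 1F ▸ const 0 ▸ ifEq 2F 0F           -- 0 p+1 w p
    (read 0 1F ▸ incr 2F ▸ read 6 1F ▸                 -- r p+2 A 0 p+1 w p
     ifEq 0F 3F
       (read 5 2F ▸                                    -- q r p+2 A 0 p+1 w p
        call translate (0F ∷ []) ▸                     -- r′ q r p+2 A 0 p+1 w p
        write 6 4F 0F ▸ write 4 5F 3F ▸ ret 0F) ▸
     write 4 3F 1F ▸ ret 0F) ▸
  const 1 ▸ ifEq 3F 0F                                 -- 1 0 p+1 w p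
    (call alloc (1F ∷ 1F ∷ 1F ∷ []) ▸ write 4 2F 3F ▸ ret 0F) ▸
  const 2 ▸ ifEq 4F 0F                                 -- 2 1 0 p+1 w p
    (call alloc (1F ∷ 2F ∷ 2F ∷ []) ▸ write 4 3F 4F ▸ ret 0F) ▸
  const 3 ▸ ifEq 5F 0F                                 -- 3 2 1 0 p+1 w p
    (read 0 4F ▸ incr 0F ▸ incr 6F ▸                   -- p+2 a+1 a 3 2 1 0 p+1 w p
     call translate (0F ∷ []) ▸
     read 4 7F ▸                                       -- q r p+2 a+1 a 3 2 1 0 p+1 w p
     -- The stem cell of `a(x)`. Its label is `a+1` because `withBottom` gives 0 to ⊥; of the two
     -- zeros, the first is the identity context and the second the output variable ⊥.
     call alloc (3F ∷ 8F ∷ 8F ∷ []) ▸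
     call alloc (0F ∷ 9F ∷ 9F ∷ []) ▸
     call graft (0F ∷ 3F ∷ []) ▸                       -- v f m q r p+2 a+1 a 3 2 1 0 p+1 w p
     write 4 (# 11) 3F ▸ ret 0F) ▸
  call translate (4F ∷ []) ▸
  read 4 4F ▸                                          -- q₁ r₁ 3 2 1 0 p+1 w p
  call translate (0F ∷ []) ▸
  read 4 6F ▸                                          -- q₂ r₂ q₁ r₁ 3 2 1 0 p+1 w p
  const 4 ▸ ifEq (# 10) 0F                             -- 4 q₂ r₂ q₁ r₁ 3 2 1 0 p+1 w p
    joinCode ▸
  call graft (4F ∷ 2F ∷ []) ▸                          -- v 4 q₂ r₂ q₁ r₁ 3 2 1 0 p+1 w p
  write 4 9F 2F ▸ ret 0F

mainBody : Code arity 0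
mainBody =
  const 0 ▸ const 1 ▸ const 2 ▸ const 3 ▸              -- 3 2 1 0
  read 0 3F ▸ read 0 3F ▸                              -- S n 3 2 1 0
  call locate (5F ∷ 1F ∷ 3F ∷ []) ▸                    -- _ S n 3 2 1 0
  -- The output starts behind its two header words. The heap starts at 2 because in a first field 0
  -- and 1 mean "closed" and `x`, and because 0 marks a missing translation.
  write 2 6F 4F ▸ write 7 6F 4F ▸
  -- The words `3 0 1` make the leaf ⊥ output variable 0.
  call put (3F ∷ []) ▸ call put (7F ∷ []) ▸ call put (7F ∷ []) ▸
  write 3 9F 8F ▸                                      -- _ _ _ _ S n 3 2 1 0
  read 5 4F ▸ call translate (0F ∷ []) ▸               -- r q _ _ _ _ S n 3 2 1 0
  read 9 0F ▸ call apply (0F ∷ # 12 ∷ []) ▸            -- v l r q _ _ _ _ S n 3 2 1 0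
  read 3 (# 13) ▸                                      -- c v l r q _ _ _ _ S n 3 2 1 0
  write 1 (# 14) 0F ▸ write 1 (# 13) 1F ▸
  read 2 (# 14) ▸ ret 0F

translator : Program
translator = record
  { #procs = 11
  ; arity  = arity
  ; body   = λ where
      skip      → skipBody
      locate    → locateBody
      put       → putBody
      emitLeft  → emitLeftBody
      emitRight → emitRightBody
      emitComp  → emitCompBody
      compose   → composeBody
      apply     → applyBody
      alloc     → allocBody
      graft     → graftBody
      translate → translateBody
  ; main   = mainBody
  }

-- Memory

Holds : (ℕ → ℕ) → ℕ → List ℕ → Set
Holds g p []       = ⊤
Holds g p (w ∷ ws) = g p ≡ w × Holds g (suc p) ws

Holds-++⁻ : ∀ {g p} us {vs} → Holds g p (us ++ vs) → Holds g p us × Holds g (length us + p) vs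
Holds-++⁻         []       h       = tt , h
Holds-++⁻ {g} {p} (u ∷ us) {vs} (e , h) with Holds-++⁻ us h
... | h₁ , h₂ = (e , h₁) , subst (λ q → Holds g q vs) (+-suc (length us) p) h₂

Holds-++⁺ : ∀ {g p} us {vs} → Holds g p us → Holds g (length us + p) vs → Holds g p (us ++ vs)
Holds-++⁺         []       h₁       h₂ = h₂
Holds-++⁺ {g} {p} (u ∷ us) {vs} (e , h₁) h₂ =
  e , Holds-++⁺ us h₁ (subst (λ q → Holds g q vs) (sym (+-suc (length us) p)) h₂)

Holds-cong : ∀ {g h p} ws → (∀ i → p ≤ i → i < length ws + p → h i ≡ g i) →
             Holds g p ws → Holds h p ws
Holds-cong []       eq hs       = tt
Holds-cong {p = p} (w ∷ ws) eq (e , hs) =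
  trans (eq p ≤-refl (s≤s (m≤n+m p _))) e ,
  Holds-cong ws (λ i p<i i< → eq i (<⇒≤ p<i) (subst (i <_) (+-suc (length ws) p) i<)) hs

Holds-contents : ∀ ws → Holds (contents ws) 0 ws
Holds-contents ws = go (contents ws) ws 0 λ i → cong (contents ws) (+-identityʳ i)
  where
  go : ∀ g ws p → (∀ i → g (i + p) ≡ contents ws i) → Holds g p ws
  go g []       p eq = tt
  go g (w ∷ ws) p eq = eq 0 , go g ws (suc p) λ i → trans (cong g (+-suc i p)) (eq (suc i))

Holds-applyUpTo : ∀ {g} ws → Holds g 0 ws → applyUpTo g (length ws) ≡ ws
Holds-applyUpTo {g} ws h = go g ws 0 h λ i → cong g (+-identityʳ i)
  where
  go : ∀ {g} g′ ws p → Holds g p ws → (∀ i → g (i + p) ≡ g′ i) →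
       applyUpTo g′ (length ws) ≡ ws
  go     g′ []       p h       eq = refl
  go {g} g′ (w ∷ ws) p (e , h) eq =
    cong₂ _∷_ (trans (sym (eq 0)) e)
              (go (λ i → g′ (suc i)) ws (suc p) h λ i → trans (cong g (+-suc i p)) (eq (suc i)))

update-same : ∀ i {x y : ℕ} → (if i ≡ᵇ i then x else y) ≡ x
update-same zero    = refl
update-same (suc i) = update-same i

update-other : ∀ {i j} {x y : ℕ} → i ≢ j → (if i ≡ᵇ j then x else y) ≡ y
update-other {zero}  {zero}  i≢j = contradiction refl i≢j
update-other {zero}  {suc j} i≢j = refl
update-other {suc i} {zero}  i≢j = refl
update-other {suc i} {suc j} i≢j = update-other {i} {j} λ e → i≢j (cong suc e)

-- The memory is written exactly as the machine produces it, so the run lemmas need constructors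
-- only.
putᴹ : ℕ → Memory → Memory
putᴹ w M = (M [ 1 , M 2 0 ]≔ w) [ 2 , 0 ]≔ suc (M 2 0)

putsᴹ : List ℕ → Memory → Memory
putsᴹ []       M = M
putsᴹ (w ∷ ws) M = putsᴹ ws (putᴹ w M)

emitᴹ : List ℕ → Memory → Memory
emitᴹ ws M = putsᴹ ws M [ 3 , 0 ]≔ suc (putsᴹ ws M 3 0)

putsᴹ-3+ : ∀ ws M k i → putsᴹ ws M (3 + k) i ≡ M (3 + k) i
putsᴹ-3+ []       M k i = refl
putsᴹ-3+ (w ∷ ws) M k i = putsᴹ-3+ ws (putᴹ w M) k i

putsᴹ-0 : ∀ ws M i → putsᴹ ws M 0 i ≡ M 0 i
putsᴹ-0 []       M i = refl
putsᴹ-0 (w ∷ ws) M i = putsᴹ-0 ws (putᴹ w M) i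

Output : Memory → List ℕ → Set
Output M ws = M 2 0 ≡ length ws + 2 × Holds (M 1) 2 ws

put-output : ∀ w {M us} → Output M us → Output (putᴹ w M) (us ++ w ∷ [])
put-output w {M} {us} (e , h) =
  trans (cong suc e) (cong (_+ 2) (sym (trans (length-++ us) (+-comm (length us) 1)))) ,
  Holds-++⁺ us
    (Holds-cong us (λ i _ i< → update-other λ e′ → <-irrefl (trans (sym e′) e) i<) h)
    (trans (cong (λ j → if M 2 0 ≡ᵇ j then w else M 1 j) (sym e)) (update-same (M 2 0)) , tt)

puts-output : ∀ ws {M us} → Output M us → Output (putsᴹ ws M) (us ++ ws)
puts-output []       {M} {us} o = subst (Output M) (sym (++-identityʳ us)) o
puts-output (w ∷ ws) {M} {us} o =
  subst (Output (putsᴹ (w ∷ ws) M)) (++-assoc us (w ∷ []) ws) (puts-output ws (put-output w {M} o))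

put-run : ∀ w M → Run translator putBody (w ∷ []) M 6 (suc (M 2 0)) (putᴹ w M)
put-run w M = const (read (write (incr (write ret))))

finish-run : ∀ {n} (η : Vec ℕ n) M → Run translator finish η M 5 (M 3 0) (M [ 3 , 0 ]≔ suc (M 3 0))
finish-run η M = const (read (incr (write ret)))

emitLeft-run : ∀ a t M → let ws = 3 ∷ a ∷ 4 ∷ 2 ∷ 0 ∷ t ∷ [] in
  Run translator emitLeftBody (a ∷ t ∷ []) M 51 (M 3 0) (emitᴹ ws M)
emitLeft-run a t M =
  const (call (put-run _ _) (call (put-run _ _) (const (call (put-run _ _) (const (call (put-run _ _)
  (const (call (put-run _ _) (call (put-run _ _) (finish-run _ _))))))))))

emitRight-run : ∀ a t M → let ws = 3 ∷ a ∷ 4 ∷ 0 ∷ t ∷ 2 ∷ [] in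
  Run translator emitRightBody (a ∷ t ∷ []) M 51 (M 3 0) (emitᴹ ws M)
emitRight-run a t M =
  const (call (put-run _ _) (call (put-run _ _) (const (call (put-run _ _) (const (call (put-run _ _)
  (call (put-run _ _) (const (call (put-run _ _) (finish-run _ _))))))))))

emitComp-run : ∀ p q M → let ws = 5 ∷ 0 ∷ p ∷ 0 ∷ q ∷ [] in
  Run translator emitCompBody (p ∷ q ∷ []) M 42 (M 3 0) (emitᴹ ws M)
emitComp-run p q M =
  const (call (put-run _ _) (const (call (put-run _ _) (call (put-run _ _) (call (put-run _ _)
  (call (put-run _ _) (finish-run _ _)))))))

alloc-run : ∀ u v w M →
  Run translator allocBody (u ∷ v ∷ w ∷ []) M 8 (M 7 0)
    ((((M [ 8 , M 7 0 ]≔ u) [ 9 , M 7 0 ]≔ v) [ 10 , M 7 0 ]≔ w) [ 7 , 0 ]≔ suc (M 7 0))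
alloc-run u v w M = const (read (write (write (write (incr (write ret))))))

-- Correctness

record Cell (M : Memory) (i u v w : ℕ) : Set where
  field
    lower : 2 ≤ i
    upper : i < M 7 0
    fst   : M 8 i ≡ u
    snd   : M 9 i ≡ v
    thd   : M 10 i ≡ w

-- Optional contexts: output variable 0 is ⊥ and thus no context, so that 0 can stand for x.
data Opt {Σ : Set} (is : List (Ins Σ)) : ℕ → Forestₓ (Maybe Σ) → Set where
  none : Opt is 0 (param tt ∷ [])
  some : ∀ {k c} → k ≢ 0 → Val is k c → InF₁ c → Opt is k c

-- A memo entry is built from one derivation, but the invariant promises a representation of
-- whatever value is derived.
⇓-deterministic : ∀ {Σ : Set} {n} {ρ : Fin n → Expr Σ n} {e f g} → ρ ⊢ e ⇓ f → ρ ⊢ e ⇓ g → f ≡ g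
⇓-deterministic (var d)       (var d′)        = ⇓-deterministic d d′
⇓-deterministic ε             ε               = refl
⇓-deterministic x             x               = refl
⇓-deterministic (lab d)       (lab d′)        = cong (λ f → node _ f ∷ []) (⇓-deterministic d d′)
⇓-deterministic (hor d e _)   (hor d′ e′ _)   = cong₂ _++_ (⇓-deterministic d d′) (⇓-deterministic e e′)
⇓-deterministic (ver d e _)   (ver d′ e′ _)   = cong₂ _⟪_⟫ (⇓-deterministic d d′) (⇓-deterministic e e′)

len₊ : ∀ {Σ : Set} {n} (num : Σ → ℕ) (e : Expr Σ n) → 1 ≤ length (encodeExpr num e)
len₊ num (var A)     = s≤s z≤n
len₊ num ε           = s≤s z≤n
len₊ num x           = s≤s z≤n
len₊ num (lab a e)   = s≤s z≤n
len₊ num (e₁ · e₂)   = s≤s z≤n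
len₊ num (e₁ ⟨ e₂ ⟩) = s≤s z≤n

read′ : ∀ {n} {η : Vec ℕ n} {M k i c t v M′ w} → M k (lookupᵛ η i) ≡ w →
        Run translator c (w ∷ η) M t v M′ → Run translator (read k i c) η M (suc t) v M′
read′ refl r = read r

ret′ : ∀ {n} {η : Vec ℕ n} {M i v} → lookupᵛ η i ≡ v → Run translator (ret i) η M 1 v M
ret′ refl = ret

-- K bounds the time and the output that the traversal spends on a node of a right-hand side.
module Translation {Σ : Set} (num : Σ → ℕ) (F : FSLP Σ) (K : ℕ) (K≥1000 : 1000 ≤ K) where

  open FSLP F using (acyclic; ground) renaming (#vars to N; start to S; rhs to ρ)

  State : Set
  State = List (Ins Σ) × Memory

  prog : State → List (Ins Σ)
  prog = proj₁

  mem : State → Memory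
  mem = proj₂

  len : Expr Σ N → ℕ
  len e = length (encodeExpr num e)

  input : ℕ → ℕ
  input = contents (encode num F)

  offset : ∀ {n} → (Fin n → Expr Σ N) → ℕ → Fin n → ℕ
  offset ρ p zero    = p
  offset ρ p (suc A) = offset (λ B → ρ (suc B)) (len (ρ zero) + p) A

  -- A cell (m, l, r) with m = 0 represents f ∈ F₀ by l alone.  Otherwise it represents l t r, where
  -- t = x if m = 1, and t = a(f′) if m is the cell of (a, p, u) with fcns (f′⟨g⟩) = p⟨ctx g⟨u⟩⟩.
  data Stem (s : State) : ℕ → Forestₓ Σ → Set where
    hole : Stem s 1 (param tt ∷ [])
    stem : ∀ {m a p u f c d} → Cell (mem s) m (suc (num a)) p u →
           Opt (prog s) p c → Val (prog s) u d → InF₀ d → InF₁ f →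
           (∀ h → fcns₁ (plug f h) ≡ c ⟪ ctx h ⟪ d ⟫ ⟫) → Stem s m (node a f ∷ [])

  data Rep (s : State) (i : ℕ) : Forestₓ Σ → Set where
    closed : ∀ {l r f} → Cell (mem s) i 0 l r → Opt (prog s) l (ctx f) → Rep s i (embed f)
    open₁  : ∀ {m l r f t g} → Cell (mem s) i m l r → Stem s m t →
             Opt (prog s) l (ctx f) → Opt (prog s) r (ctx g) → Rep s i (embed f ++ t ++ embed g)

  infix 3 _≼_

  -- Output and heap only grow and used cells are never overwritten, so every representation
  -- survives later steps.
  record _≼_ (s s′ : State) : Set where
    field
      grows : ∃[ js ] prog s′ ≡ prog s ++ js
      used  : mem s 7 0 ≤ mem s′ 7 0
      keeps : ∀ i → i < mem s 7 0 →
              mem s′ 8 i ≡ mem s 8 i × mem s′ 9 i ≡ mem s 9 i × mem s′ 10 i ≡ mem s 10 i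

  open _≼_

  ≼-refl : ∀ {s} → s ≼ s
  ≼-refl .grows = [] , sym (++-identityʳ _)
  ≼-refl .used = ≤-refl
  ≼-refl .keeps _ _ = refl , refl , refl

  ≼-trans : ∀ {s s′ s″} → s ≼ s′ → s′ ≼ s″ → s ≼ s″
  ≼-trans p q .grows with grows p | grows q
  ... | js , refl | ks , refl = js ++ ks , ++-assoc _ js ks
  ≼-trans p q .used = ≤-trans (used p) (used q)
  ≼-trans p q .keeps i i< with keeps p i i< | keeps q i (≤-trans i< (used p))
  ... | a , b , c | a′ , b′ , c′ = trans a′ a , trans b′ b , trans c′ c

  Cell-≼ : ∀ {s s′ i u v w} → s ≼ s′ → Cell (mem s) i u v w → Cell (mem s′) i u v w
  Cell-≼ {i = i} p c with keeps p i (Cell.upper c)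
  ... | a , b , d = record
    { lower = Cell.lower c
    ; upper = ≤-trans (Cell.upper c) (used p)
    ; fst   = trans a (Cell.fst c)
    ; snd   = trans b (Cell.snd c)
    ; thd   = trans d (Cell.thd c)
    }

  Val-≼ : ∀ {s s′ k c} → s ≼ s′ → Val (prog s) k c → Val (prog s′) k c
  Val-≼ p v with grows p
  ... | js , refl = Val-++ js v

  Opt-≼ : ∀ {s s′ k c} → s ≼ s′ → Opt (prog s) k c → Opt (prog s′) k c
  Opt-≼ p none           = none
  Opt-≼ p (some k≢0 v c) = some k≢0 (Val-≼ p v) c

  Stem-≼ : ∀ {s s′ m t} → s ≼ s′ → Stem s m t → Stem s′ m t
  Stem-≼ p hole                  = hole
  Stem-≼ p (stem c o v c₀ c₁ eq) = stem (Cell-≼ p c) (Opt-≼ p o) (Val-≼ p v) c₀ c₁ eq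

  Rep-≼ : ∀ {s s′ i f} → s ≼ s′ → Rep s i f → Rep s′ i f
  Rep-≼ p (closed c o)    = closed (Cell-≼ p c) (Opt-≼ p o)
  Rep-≼ p (open₁ c t o q) = open₁ (Cell-≼ p c) (Stem-≼ p t) (Opt-≼ p o) (Opt-≼ p q)

  record Inv (s : State) : Set where
    field
      output : Output (mem s) (code num (prog s))
      count  : mem s 3 0 ≡ length (prog s)
      wf     : WellFormed (prog s)
      bottom : prog s [ 0 ]= bot
      heap   : 2 ≤ mem s 7 0
      inp    : ∀ i → mem s 0 i ≡ input i
      pos    : ∀ A → mem s 5 (toℕ A) ≡ offset ρ 2 A
      memo   : ∀ A → mem s 6 (toℕ A) ≡ 0 ⊎
                     (∀ f → ρ ⊢ var A ⇓ f → Rep s (mem s 6 (toℕ A)) f)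

  open Inv

  pending : (Fin N → ℕ) → Memory → Fin N → ℕ
  pending w M A = if M 6 (toℕ A) ≡ᵇ 0 then w A else 0

  -- The total weight of the variables that have not been translated yet pays for their translation.
  potential : (Fin N → ℕ) → Memory → ℕ
  potential w M = total (pending w M)

  -- The output produced so far is part of the state and is counted in `sizePotential`; elapsed time
  -- is not, and is added in `Exec`.
  timePotential sizePotential : State → ℕ
  timePotential s = potential (λ A → K * len (ρ A)) (mem s)
  sizePotential s = potential (λ A → K * #ops (ρ A)) (mem s) + sum (map cost (prog s))

  -- A Hoare triple with amortised budgets `T` for time and `Z` for output. Only memo entries of
  -- variables in `D` may change, which is how a variable is known to be still untranslated after
  -- the traversal of its own right-hand side.
  record Exec (D : Fin N → Set) {n} (c : Code arity n) (η : Vec ℕ n) (s : State)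
              (T Z : ℕ) (Q : ℕ → State → Set) : Set where
    field
      time value : ℕ
      final      : State
      run        : Run translator c η (mem s) time value (mem final)
      inv        : Inv final
      ext        : s ≼ final
      frame      : ∀ A → ¬ D A → mem final 6 (toℕ A) ≡ mem s 6 (toℕ A)
      time≤      : time + timePotential final ≤ T + timePotential s
      size≤      : sizePotential final ≤ Z + sizePotential s
      post       : Q value final

  open Exec

  private variable
    D D′ : Fin N → Set
    n : ℕ
    c c′ : Code arity n
    η : Vec ℕ n
    s s′ : State
    T T′ Z Z′ w : ℕ
    i j : Fin n
    Q R : ℕ → State → Set

  -- Execution rules with amortised budgets

  retE : Inv s → Q (lookupᵛ η i) s → Exec D (ret i) η s 1 0 Q
  retE I q = record
    { run = ret; inv = I; ext = ≼-refl; frame = λ _ _ → refl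
    ; time≤ = ≤-refl; size≤ = ≤-refl; post = q }

  constE : Exec D c (w ∷ η) s T Z Q → Exec D (const w c) η s (suc T) Z Q
  constE E = record
    { run = const (run E); inv = inv E; ext = ext E; frame = frame E
    ; time≤ = s≤s (time≤ E); size≤ = size≤ E; post = post E }

  incrE : Exec D c (suc (lookupᵛ η i) ∷ η) s T Z Q → Exec D (incr i c) η s (suc T) Z Q
  incrE E = record
    { run = incr (run E); inv = inv E; ext = ext E; frame = frame E
    ; time≤ = s≤s (time≤ E); size≤ = size≤ E; post = post E }

  readE : mem s k (lookupᵛ η i) ≡ w → Exec D c (w ∷ η) s T Z Q →
          Exec D (read k i c) η s (suc T) Z Q
  readE refl E = record
    { run = read (run E); inv = inv E; ext = ext E; frame = frame E
    ; time≤ = s≤s (time≤ E); size≤ = size≤ E; post = post E }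

  ifEqE : lookupᵛ η i ≡ lookupᵛ η j → Exec D c η s T Z Q →
          Exec D (ifEq i j c c′) η s (suc T) Z Q
  ifEqE e E = record
    { run = ifEq e (run E); inv = inv E; ext = ext E; frame = frame E
    ; time≤ = s≤s (time≤ E); size≤ = size≤ E; post = post E }

  ifNeqE : lookupᵛ η i ≢ lookupᵛ η j → Exec D c′ η s T Z Q →
           Exec D (ifEq i j c c′) η s (suc T) Z Q
  ifNeqE e E = record
    { run = ifNeq e (run E); inv = inv E; ext = ext E; frame = frame E
    ; time≤ = s≤s (time≤ E); size≤ = size≤ E; post = post E }

  -- Amortised costs add up because the intermediate potential `φ₁` cancels.
  pay : ∀ {t u a b} φ₀ φ₁ φ₂ → t + φ₁ ≤ a + φ₀ → u + φ₂ ≤ b + φ₁ → (t + u) + φ₂ ≤ (a + b) + φ₀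
  pay {t} {u} {a} {b} φ₀ φ₁ φ₂ p q = begin
    (t + u) + φ₂ ≡⟨ +-assoc t u φ₂ ⟩
    t + (u + φ₂) ≤⟨ +-monoʳ-≤ t q ⟩
    t + (b + φ₁) ≡⟨ x∙yz≈y∙xz t b φ₁ ⟩
    b + (t + φ₁) ≤⟨ +-monoʳ-≤ b p ⟩
    b + (a + φ₀) ≡⟨ x∙yz≈yx∙z b a φ₀ ⟩
    (a + b) + φ₀ ∎
    where
    open ≤-Reasoning

  callE : ∀ {p is} →
          Exec D (Program.body translator p) (mapᵛ (lookupᵛ η) is) s T Z Q →
          (∀ {v s′} → Inv s′ → s ≼ s′ → Q v s′ → Exec D c (v ∷ η) s′ T′ Z′ R) →
          Exec D (call p is c) η s (suc (T + T′)) (Z + Z′) R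
  callE {s = s} {Z = Z} {Z′ = Z′} E k = record
    { run = call (run E) (run E′); inv = inv E′; ext = ≼-trans (ext E) (ext E′)
    ; frame = λ A ¬D → trans (frame E′ A ¬D) (frame E A ¬D)
    ; time≤ = s≤s (pay (timePotential s) (timePotential (final E)) (timePotential (final E′))
                       (time≤ E) (time≤ E′))
    ; size≤ = pay {0} {0} {Z} {Z′} (sizePotential s) (sizePotential (final E)) (sizePotential (final E′))
                  (size≤ E) (size≤ E′)
    ; post = post E′ }
    where E′ = k (inv E) (ext E) (post E)

  weakenE : T ≤ T′ → Z ≤ Z′ → Exec D c η s T Z Q → Exec D c η s T′ Z′ Q
  weakenE p q E = record
    { run = run E; inv = inv E; ext = ext E; frame = frame E
    ; time≤ = ≤-trans (time≤ E) (+-monoˡ-≤ _ p)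
    ; size≤ = ≤-trans (size≤ E) (+-monoˡ-≤ _ q); post = post E }

  frameE : (∀ {A} → D A → D′ A) → Exec D c η s T Z Q → Exec D′ c η s T Z Q
  frameE sub E = record
    { run = run E; inv = inv E; ext = ext E; frame = λ A ¬D′ → frame E A (λ d → ¬D′ (sub d))
    ; time≤ = time≤ E; size≤ = size≤ E; post = post E }

  mapE : (∀ {v s′} → Q v s′ → R v s′) → Exec D c η s T Z Q → Exec D c η s T Z R
  mapE f E = record
    { run = run E; inv = inv E; ext = ext E; frame = frame E
    ; time≤ = time≤ E; size≤ = size≤ E; post = f (post E) }

  postE : (E : Exec D c η s T Z Q) → R (value E) (final E) → Exec D c η s T Z R
  postE E r = record
    { run = run E; inv = inv E; ext = ext E; frame = frame E
    ; time≤ = time≤ E; size≤ = size≤ E; post = r }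

  moved : ∀ i v → s ≼ prog s , (mem s [ 4 , i ]≔ v)
  moved {s} i v = record { grows = grows (≼-refl {s}); used = ≤-refl; keeps = λ _ _ → refl , refl , refl }

  Inv-≼ : ∀ {is M M′} → Inv (is , M) → is , M ≼ is , M′ → (∀ i → M′ 0 i ≡ M 0 i) →
          (∀ i → M′ 1 i ≡ M 1 i) → M′ 2 0 ≡ M 2 0 → M′ 3 0 ≡ M 3 0 →
          (∀ i → M′ 5 i ≡ M 5 i) → (∀ i → M′ 6 i ≡ M 6 i) → Inv (is , M′)
  Inv-≼ {is} {M} {M′} I e e₀ e₁ e₂ e₃ e₅ e₆ = record
    { output = trans e₂ (proj₁ (output I)) ,
               Holds-cong (code num is) (λ i _ _ → e₁ i) (proj₂ (output I))
    ; count  = trans e₃ (count I)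
    ; wf     = wf I
    ; bottom = bottom I
    ; heap   = ≤-trans (heap I) (used e)
    ; inp    = λ i → trans (e₀ i) (inp I i)
    ; pos    = λ A → trans (e₅ _) (pos I A)
    ; memo   = λ A → memo′ A (memo I A)
    }
    where
    memo′ : ∀ A → M 6 (toℕ A) ≡ 0 ⊎ (∀ f → ρ ⊢ var A ⇓ f → Rep (is , M) (M 6 (toℕ A)) f) →
            M′ 6 (toℕ A) ≡ 0 ⊎ (∀ f → ρ ⊢ var A ⇓ f → Rep (is , M′) (M′ 6 (toℕ A)) f)
    memo′ A (inj₁ z) = inj₁ (trans (e₆ _) z)
    memo′ A (inj₂ r) = inj₂ λ f d →
      subst (λ i → Rep (is , M′) i f) (sym (e₆ _)) (Rep-≼ e (r f d))

  Inv-move : ∀ i v → Inv s → Inv (prog s , (mem s [ 4 , i ]≔ v))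
  Inv-move {s} i v I = Inv-≼ I (moved {s} i v) (λ _ → refl) (λ _ → refl) refl refl (λ _ → refl) (λ _ → refl)

  moveE : Exec D c η (prog s , (mem s [ 4 , lookupᵛ η i ]≔ lookupᵛ η j)) T Z Q →
          Exec D (write 4 i j c) η s (suc T) Z Q
  moveE {η = η} {s = s} {i = i} {j = j} E = record
    { run = write (run E); inv = inv E
    ; ext = ≼-trans (moved {s} (lookupᵛ η i) (lookupᵛ η j)) (ext E); frame = frame E
    ; time≤ = s≤s (time≤ E); size≤ = size≤ E; post = post E }

  -- Emitting instructions and allocating cells

  emitE : ∀ {f} (ins : Ins Σ) →
          Run translator c η (mem s) T (mem s 3 0) (emitᴹ (encodeIns num ins) (mem s)) →
          Inv s → Val (prog s ++ ins ∷ []) (length (prog s)) f →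
          Exec D c η s T (cost ins) λ v s′ → v ≢ 0 × Val (prog s′) v f
  emitE {s = is , M} {D = D} ins r I val = record
    { final = is ++ ins ∷ [] , M′
    ; run   = r
    ; inv   = record
      { output = subst (Output M′) (sym code-snoc) (puts-output ws {M} (output I))
      ; count  = trans (cong suc (trans (putsᴹ-3+ ws M 0 0) (count I)))
                       (sym (trans (length-++ is) (+-comm (length is) 1)))
      ; wf     = wf′
      ; bottom = []=-++ (ins ∷ []) (bottom I)
      ; heap   = subst (2 ≤_) (sym (same 3 0)) (heap I)
      ; inp    = λ i → trans (putsᴹ-0 ws M i) (inp I i)
      ; pos    = λ A → trans (same 1 (toℕ A)) (pos I A)
      ; memo   = λ A → memo′ A (memo I A)
      }
    ; ext   = e
    ; frame = λ A _ → same 2 (toℕ A)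
    ; time≤ = ≤-reflexive (cong (_ +_) (potential-same _))
    ; size≤ = ≤-reflexive (trans (cong₂ _+_ (potential-same _) cost-snoc)
                                 (x∙yz≈z∙xy (potential _ M) (sum (map cost is)) (cost ins)))
    -- The list already contains ⊥ at index 0, so the new number differs from 0, the code of the
    -- identity context.
    ; post  = (λ z → <⇒≢ (≤-<-trans z≤n ([]=-< (bottom I))) (sym (trans (sym (count I)) z))) ,
              subst (λ v → Val (is ++ ins ∷ []) v _) (sym (count I)) val
    }
    where
    ws = encodeIns num ins
    M′ = emitᴹ ws M
    same : ∀ k i → M′ (4 + k) i ≡ M (4 + k) i
    same k i = putsᴹ-3+ ws M (suc k) i
    e : is , M ≼ is ++ ins ∷ [] , M′
    e = record { grows = ins ∷ [] , refl; used = ≤-reflexive (sym (same 3 0))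
               ; keeps = λ i _ → same 4 i , same 5 i , same 6 i }
    code-snoc : code num (is ++ ins ∷ []) ≡ code num is ++ ws
    code-snoc = trans (concatMap-++ (encodeIns num) is (ins ∷ []))
                      (cong (code num is ++_) (++-identityʳ ws))
    cost-snoc : sum (map cost (is ++ ins ∷ [])) ≡ sum (map cost is) + cost ins
    cost-snoc = trans (cong sum (map-++ cost is (ins ∷ [])))
                      (trans (sum-++ (map cost is) _) (cong (_ +_) (+-identityʳ (cost ins))))
    potential-same : ∀ w → potential w M′ ≡ potential w M
    potential-same w = total-cong λ A → cong (λ m → if m ≡ᵇ 0 then w A else 0) (same 2 (toℕ A))
    wf′ : WellFormed (is ++ ins ∷ [])
    wf′ k k< with k <? length is
    ... | yes k<′ = let f , v = wf I k k<′ in f , Val-++ (ins ∷ []) v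
    ... | no  k≮  = _ , subst (λ k → Val (is ++ ins ∷ []) k _)
      (≤-antisym (≮⇒≥ k≮) (s≤s⁻¹ (subst (k <_) (trans (length-++ is) (+-comm (length is) 1)) k<))) val
    memo′ : ∀ A → M 6 (toℕ A) ≡ 0 ⊎ (∀ f → ρ ⊢ var A ⇓ f → Rep (is , M) (M 6 (toℕ A)) f) →
            M′ 6 (toℕ A) ≡ 0 ⊎ (∀ f → ρ ⊢ var A ⇓ f → Rep (is ++ ins ∷ [] , M′) (M′ 6 (toℕ A)) f)
    memo′ A (inj₁ z) = inj₁ (trans (same 2 (toℕ A)) z)
    memo′ A (inj₂ r) = inj₂ λ f d →
      subst (λ i → Rep _ i f) (sym (same 2 (toℕ A))) (Rep-≼ e (r f d))

  allocE : ∀ {u v w} → Inv s →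
           Exec D allocBody (u ∷ v ∷ w ∷ []) s 8 0 λ i s′ → Cell (mem s′) i u v w
  allocE {s = is , M} {u = u} {v} {w} I = record
    { final = is , M′
    ; run   = alloc-run u v w M
    ; inv   = Inv-≼ I e (λ _ → refl) (λ _ → refl) refl refl (λ _ → refl) (λ _ → refl)
    ; ext   = e
    ; frame = λ _ _ → refl
    ; time≤ = ≤-refl
    ; size≤ = ≤-refl
    ; post  = record { lower = heap I; upper = ≤-refl
                     ; fst = update-same a; snd = update-same a; thd = update-same a }
    }
    where
    a = M 7 0
    M′ = (((M [ 8 , a ]≔ u) [ 9 , a ]≔ v) [ 10 , a ]≔ w) [ 7 , 0 ]≔ suc a
    e : is , M ≼ is , M′
    e = record { grows = grows (≼-refl {is , M}); used = n≤1+n a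
               ; keeps = λ i i< → let a≢i = λ a≡i → <⇒≢ i< (sym a≡i) in
                         update-other a≢i , update-other a≢i , update-other a≢i }

  leftE : ∀ {a t f} → Inv s → Val (prog s) t f → InF₀ f →
          Exec D emitLeftBody (suc (num a) ∷ t ∷ []) s 51 3 λ v s′ →
            Opt (prog s′) v (node (just a) (param tt ∷ f) ∷ [])
  leftE {s = is , M} {a = a} {t} I v c =
    mapE (λ (v≢0 , v) → some v≢0 v (cong (λ n → suc n + 0) c))
      (emitE (left a t) (emitLeft-run _ _ M) I (left ([]=-last is) (Val-< v) (Val-++ _ v) c))

  rightE : ∀ {a t f} → Inv s → Val (prog s) t f → InF₀ f →
           Exec D emitRightBody (suc (num a) ∷ t ∷ []) s 51 3 λ v s′ →
             Opt (prog s′) v (node (just a) (f ++ param tt ∷ []) ∷ [])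
  rightE {s = is , M} {a = a} {t} {f} I v c =
    mapE (λ (v≢0 , v) → some v≢0 v
            (trans (+-identityʳ _) (trans (#x-++ f _) (cong (_+ 1) c))))
      (emitE (right a t) (emitRight-run _ _ M) I (right ([]=-last is) (Val-< v) (Val-++ _ v) c))

  compE : ∀ {p q f g} → Inv s → Val (prog s) p f → InF₁ f → Val (prog s) q g →
          Exec D emitCompBody (p ∷ q ∷ []) s 42 1 λ v s′ → v ≢ 0 × Val (prog s′) v (f ⟪ g ⟫)
  compE {s = is , M} {p = p} {q} I v c w =
    emitE (comp p q) (emitComp-run _ _ M) I
      (comp ([]=-last is) (Val-< v) (Val-< w) (Val-++ _ v) (Val-++ _ w) c)

  composeE : ∀ {p q f g} → Inv s → Opt (prog s) p f → Opt (prog s) q g →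
             Exec D composeBody (p ∷ q ∷ []) s 50 1 λ v s′ → Opt (prog s′) v (f ⟪ g ⟫)
  composeE {g = g} I none o =
    weakenE (≤ᵇ⇒≤ _ _ tt) z≤n
      (constE (ifEqE refl (retE I (subst (Opt _ _) (sym (++-identityʳ g)) o))))
  composeE {f = f} I o@(some p≢0 _ _) none =
    weakenE (≤ᵇ⇒≤ _ _ tt) z≤n
      (constE (ifNeqE p≢0 (ifEqE refl (retE I (subst (Opt _ _) (sym (⟪⟫-identityʳ f)) o)))))
  composeE {f = f} {g} I (some p≢0 v c) (some q≢0 w d) =
    weakenE (≤ᵇ⇒≤ _ _ tt) ≤-refl
      (constE (ifNeqE p≢0 (ifNeqE q≢0 (callE (compE I v c w) λ I′ _ (v≢0 , u) →
        retE I′ (some v≢0 u (⟪⟫-InF₁ f g c d))))))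

  applyE : ∀ {p t f g} → Inv s → Opt (prog s) p f → Val (prog s) t g →
           Exec D applyBody (p ∷ t ∷ []) s 50 1 λ v s′ → Val (prog s′) v (f ⟪ g ⟫)
  applyE {g = g} I none w =
    weakenE (≤ᵇ⇒≤ _ _ tt) z≤n
      (constE (ifEqE refl (retE I (subst (Val _ _) (sym (++-identityʳ g)) w))))
  applyE I (some p≢0 v c) w =
    weakenE (≤ᵇ⇒≤ _ _ tt) ≤-refl
      (constE (ifNeqE p≢0 (callE (compE I v c w) λ I′ _ (_ , u) → retE I′ u)))

  -- Substitution on representations

  Stem-≢0 : ∀ {m t} → Stem s m t → m ≢ 0
  Stem-≢0 (stem c _ _ _ _ _) refl with () ← Cell.lower c

  Stem-InF₁ : ∀ {m t} → Stem s m t → InF₁ t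
  Stem-InF₁ hole                 = refl
  Stem-InF₁ (stem _ _ _ _ c₁ _) = trans (+-identityʳ _) c₁

  middle-InF₁ : ∀ (f : Forest₀ Σ) t (g : Forest₀ Σ) → InF₁ t → InF₁ (embed f ++ t ++ embed g)
  middle-InF₁ f t g t₁
    rewrite #x-++ (embed f) (t ++ embed g) | #x-++ t (embed g) | #x-embed f | #x-embed g | t₁ = refl

  -- The cases ask whether `x` is a root of `f`, and whether `g` is ground or has `x` as a root or
  -- below one. The output bound 7 is one `emitLeft` or `emitRight`, worth three operations, and
  -- four compositions.
  graftE : ∀ {i j f g} → Inv s → Rep s i f → InF₁ f → Rep s j g →
           Exec D graftBody (i ∷ j ∷ []) s 500 7 λ v s′ → Rep s′ v (f ⟪ g ⟫)
  graftE I (closed {f = f} _ _) f₁ _ with () ← trans (sym (#x-embed f)) f₁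
  graftE I (open₁ {f = l} {g = r} c₁ hole o p) _ (closed {f = g} c₂ q) =
    weakenE (≤ᵇ⇒≤ _ _ tt) (≤ᵇ⇒≤ _ _ tt) $
      readE (Cell.fst c₁) $ readE (Cell.snd c₁) $ readE (Cell.thd c₁) $
      readE (Cell.fst c₂) $ readE (Cell.snd c₂) $ readE (Cell.thd c₂) $
      constE $ constE $ ifEqE refl $
      callE (composeE I o q) λ I₁ e₁ o₁ → ifEqE refl $
      callE (composeE I₁ o₁ (Opt-≼ e₁ p)) λ I₂ e₂ o₂ →
      callE (allocE I₂) λ I₃ e₃ cell → retE I₃
        (subst (Rep _ _) eq (closed cell (Opt-≼ e₃ (subst (Opt _ _) ctx-eq o₂))))
    where
    ctx-eq : ctx l ⟪ ctx g ⟫ ⟪ ctx r ⟫ ≡ ctx ((l ++ g) ++ r)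
    ctx-eq = trans (cong (_⟪ ctx r ⟫) (ctx-++ l g)) (ctx-++ (l ++ g) r)
    eq : embed ((l ++ g) ++ r) ≡ (embed l ++ param tt ∷ embed r) ⟪ embed g ⟫
    eq = trans (embed-middle l g r)
      (trans (cong (λ u → embed l ++ u ++ embed r) (sym (++-identityʳ (embed g))))
             (sym (⟪⟫-middle l (param tt ∷ []) r (embed g))))
  graftE I (open₁ {f = l} {g = r} c₁ hole o p) _ (open₁ {f = l′} {t = t} {g = r′} c₂ m o′ p′) =
    weakenE (≤ᵇ⇒≤ _ _ tt) (≤ᵇ⇒≤ _ _ tt) $
      readE (Cell.fst c₁) $ readE (Cell.snd c₁) $ readE (Cell.thd c₁) $
      readE (Cell.fst c₂) $ readE (Cell.snd c₂) $ readE (Cell.thd c₂) $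
      constE $ constE $ ifEqE refl $
      callE (composeE I o o′) λ I₁ e₁ o₁ → ifNeqE (Stem-≢0 m) $
      callE (composeE I₁ (Opt-≼ e₁ p′) (Opt-≼ e₁ p)) λ I₂ e₂ o₂ →
      callE (allocE I₂) λ I₃ e₃ cell → retE I₃
        (subst (Rep _ _) eq
          (open₁ cell (Stem-≼ (≼-trans e₁ (≼-trans e₂ e₃)) m)
                 (Opt-≼ (≼-trans e₂ e₃) (subst (Opt _ _) (ctx-++ l l′) o₁))
                 (Opt-≼ e₃ (subst (Opt _ _) (ctx-++ r′ r) o₂))))
    where
    g = embed l′ ++ t ++ embed r′
    eq : embed (l ++ l′) ++ t ++ embed (r′ ++ r) ≡ (embed l ++ param tt ∷ embed r) ⟪ g ⟫
    eq = trans (nest-middle l l′ t r′ r)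
      (trans (cong (λ u → embed l ++ u ++ embed r) (sym (++-identityʳ g)))
             (sym (⟪⟫-middle l (param tt ∷ []) r g)))
  graftE I (open₁ {f = l} {g = r} c₁ (stem {a = a} {f = f} {c} {d} cm oc vd d₀ f₁ eq) o p) _
         (closed {f = g} c₂ q) =
    weakenE (≤ᵇ⇒≤ _ _ tt) (≤ᵇ⇒≤ _ _ tt) $
      readE (Cell.fst c₁) $ readE (Cell.snd c₁) $ readE (Cell.thd c₁) $
      readE (Cell.fst c₂) $ readE (Cell.snd c₂) $ readE (Cell.thd c₂) $
      constE $ constE $ ifNeqE m≢1 $
      readE (Cell.fst cm) $ readE (Cell.snd cm) $ readE (Cell.thd cm) $
      callE (composeE I oc q) λ I₁ e₁ o₁ → ifEqE refl $
      callE (applyE I₁ o₁ (Val-≼ e₁ vd)) λ I₂ e₂ v₂ →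
      callE (rightE {f = fcns₁ (plug f g)} I₂ (subst (Val _ _) val-eq v₂) (#x-embed (fcns (plug f g) ∷ [])))
        λ I₃ e₃ o₃ →
      callE (composeE I₃ (Opt-≼ (≼-trans e₁ (≼-trans e₂ e₃)) o) o₃) λ I₄ e₄ o₄ →
      callE (composeE I₄ o₄ (Opt-≼ (≼-trans e₁ (≼-trans e₂ (≼-trans e₃ e₄))) p)) λ I₅ e₅ o₅ →
      callE (allocE I₅) λ I₆ e₆ cell → retE I₆
        (subst (Rep _ _) rep-eq (closed cell (Opt-≼ e₆ (subst (Opt _ _) ctx-eq o₅))))
    where
    m≢1 : _ ≢ 1
    m≢1 e = <⇒≢ (Cell.lower cm) (sym e)
    t = node a (plug f g) ∷ []
    val-eq : c ⟪ ctx g ⟫ ⟪ d ⟫ ≡ fcns₁ (plug f g)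
    val-eq = trans (⟪⟫-assoc c (ctx g) d) (sym (eq g))
    ctx-eq : ctx l ⟪ ctx t ⟫ ⟪ ctx r ⟫ ≡ ctx ((l ++ t) ++ r)
    ctx-eq = trans (cong (_⟪ ctx r ⟫) (ctx-++ l t)) (ctx-++ (l ++ t) r)
    rep-eq : embed ((l ++ t) ++ r) ≡ (embed l ++ node a f ∷ embed r) ⟪ embed g ⟫
    rep-eq = trans (embed-middle l t r)
      (trans (cong (λ u → embed l ++ node a u ∷ embed r) (sym (embed-plug f g)))
             (sym (⟪⟫-middle l (node a f ∷ []) r (embed g))))
  graftE I (open₁ {f = l} {g = r} c₁ (stem {a = a} {f = f} {c} {d} cm oc vd d₀ f₁ eq) o p) _
         (open₁ {f = l′} {g = r′} c₂ hole o′ p′) =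
    weakenE (≤ᵇ⇒≤ _ _ tt) (≤ᵇ⇒≤ _ _ tt) $
      readE (Cell.fst c₁) $ readE (Cell.snd c₁) $ readE (Cell.thd c₁) $
      readE (Cell.fst c₂) $ readE (Cell.snd c₂) $ readE (Cell.thd c₂) $
      constE $ constE $ ifNeqE m≢1 $
      readE (Cell.fst cm) $ readE (Cell.snd cm) $ readE (Cell.thd cm) $
      callE (composeE I oc o′) λ I₁ e₁ o₁ → ifNeqE (λ ()) $
      callE (applyE I₁ (Opt-≼ e₁ p′) (Val-≼ e₁ vd)) λ I₂ e₂ v₂ → ifEqE refl $
      callE (allocE I₂) λ I₃ e₃ cell →
      callE (allocE I₃) λ I₄ e₄ cell′ → retE I₄
        -- The siblings `l′` and `r′` of `x` are absorbed into the stem of `a`, while the outer `l`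
        -- and `r` are unchanged.
        (subst (Rep _ _) (sym (⟪⟫-middle l (node a f ∷ []) r _))
          (open₁ cell′
            (stem (Cell-≼ e₄ cell) (Opt-≼ (≼-trans e₂ (≼-trans e₃ e₄)) o₁)
                  (Val-≼ (≼-trans e₃ e₄) v₂) (⟪⟫-InF₀ (ctx r′) d (ctx-InF₁ r′) d₀)
                  (⟪⟫-InF₁ f _ f₁ (middle-InF₁ l′ (param tt ∷ []) r′ refl)) (plug-flat f c d eq l′ r′))
            (Opt-≼ (≼-trans e₁ (≼-trans e₂ (≼-trans e₃ e₄))) o)
            (Opt-≼ (≼-trans e₁ (≼-trans e₂ (≼-trans e₃ e₄))) p)))
    where
    m≢1 : _ ≢ 1
    m≢1 e = <⇒≢ (Cell.lower cm) (sym e)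
  graftE I (open₁ {f = l} {g = r} c₁ (stem {a = a} {f = f} {c} {d} cm oc vd d₀ f₁ eq) o p) _
         (open₁ {f = l′} {g = r′} c₂ (stem {a = b} {f = f′} {c′} {d′} cm′ oc′ vd′ d₀′ f₁′ eq′) o′ p′) =
    weakenE (≤ᵇ⇒≤ _ _ tt) (≤ᵇ⇒≤ _ _ tt) $
      readE (Cell.fst c₁) $ readE (Cell.snd c₁) $ readE (Cell.thd c₁) $
      readE (Cell.fst c₂) $ readE (Cell.snd c₂) $ readE (Cell.thd c₂) $
      constE $ constE $ ifNeqE m≢1 $
      readE (Cell.fst cm) $ readE (Cell.snd cm) $ readE (Cell.thd cm) $
      callE (composeE I oc o′) λ I₁ e₁ o₁ → ifNeqE m′≢0 $
      callE (applyE I₁ (Opt-≼ e₁ p′) (Val-≼ e₁ vd)) λ I₂ e₂ v₂ → ifNeqE m′≢1 $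
      let e₁₂ = ≼-trans e₁ e₂; cm″ = Cell-≼ e₁₂ cm′ in
      readE (Cell.fst cm″) $ readE (Cell.snd cm″) $ readE (Cell.thd cm″) $
      callE (leftE I₂ v₂ (⟪⟫-InF₀ (ctx r′) d (ctx-InF₁ r′) d₀)) λ I₃ e₃ o₃ →
      callE (composeE I₃ (Opt-≼ (≼-trans e₂ e₃) o₁) o₃) λ I₄ e₄ o₄ →
      callE (composeE I₄ o₄ (Opt-≼ (≼-trans e₁₂ (≼-trans e₃ e₄)) oc′)) λ I₅ e₅ o₅ →
      callE (allocE I₅) λ I₆ e₆ cell →
      callE (allocE I₆) λ I₇ e₇ cell′ →
      let e₁₋₇ = ≼-trans e₁₂ (≼-trans e₃ (≼-trans e₄ (≼-trans e₅ (≼-trans e₆ e₇)))) in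
      retE I₇
        (subst (Rep _ _) (sym (⟪⟫-middle l (node a f ∷ []) r _))
          (open₁ cell′
            (stem (Cell-≼ e₇ cell) (Opt-≼ (≼-trans e₆ e₇) o₅)
                  (Val-≼ e₁₋₇ vd′) d₀′
                  (⟪⟫-InF₁ f _ f₁ (middle-InF₁ l′ (node b f′ ∷ []) r′ (trans (+-identityʳ _) f₁′)))
                  (plug-nested f c d eq d₀ b f′ c′ d′ eq′ l′ r′))
            (Opt-≼ e₁₋₇ o) (Opt-≼ e₁₋₇ p)))
    where
    m≢1 : _ ≢ 1
    m≢1 e = <⇒≢ (Cell.lower cm) (sym e)
    m′≢1 : _ ≢ 1
    m′≢1 e = <⇒≢ (Cell.lower cm′) (sym e)
    m′≢0 : _ ≢ 0
    m′≢0 refl with () ← Cell.lower cm′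

  -- Memoized traversal

  Reaches : List (Fin N) → Fin N → Set
  Reaches As B = ∃[ A ] A ∈ As × Star (_↝_ ρ) A B

  Reach : Expr Σ N → Fin N → Set
  Reach e = Reaches (vars e)

  -- Thanks to this, the memo entry of `A` is still 0, and its credit unspent, when the translation
  -- of `ρ A` returns.
  unreachable : ∀ A → ¬ Reach (ρ A) A
  unreachable A (B , p , q) = acyclic A (closure p q)
    where
    closure : ∀ {A B C} → _↝_ ρ A B → Star (_↝_ ρ) B C → TransClosure (_↝_ ρ) A C
    closure p ε       = [ p ]
    closure p (q ◅ r) = p ∷ closure q r

  Reach-var : ∀ {A B} → Reach (ρ A) B → Reach (var A) B
  Reach-var (C , p , q) = _ , here refl , p ◅ q

  Reaches-++ˡ : ∀ {As Bs B} → Reaches As B → Reaches (As ++ Bs) B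
  Reaches-++ˡ (A , p , q) = A , ∈-++⁺ˡ p , q

  Reaches-++ʳ : ∀ As {Bs B} → Reaches Bs B → Reaches (As ++ Bs) B
  Reaches-++ʳ As (A , p , q) = A , ∈-++⁺ʳ As p , q

  budget₀ : ∀ {a} l → a ≤ 1000 → a ≤ K * suc l
  budget₀ {a} l p = ≤-trans p (≤-trans K≥1000 (≤-trans (≤-reflexive (sym (*-identityʳ K)))
                                                       (*-monoʳ-≤ K (s≤s z≤n))))

  budget₁ : ∀ a c l → a + c ≤ 1000 → a + (K * l + c) ≤ K * suc l
  budget₁ a c l p = begin
    a + (K * l + c) ≡⟨ x∙yz≈xz∙y a (K * l) c ⟩
    (a + c) + K * l ≤⟨ +-monoˡ-≤ (K * l) (≤-trans p K≥1000) ⟩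
    K + K * l       ≡⟨ *-suc K l ⟨
    K * suc l       ∎
    where
    open ≤-Reasoning

  -- `a`, `b` and `c` are the fixed costs before, between and after the two recursive translations;
  -- one more unit of `K` covers them all.
  budget₂ : ∀ a b c l₁ l₂ → a + b + c ≤ 1000 →
            a + (K * l₁ + (b + (K * l₂ + c))) ≤ K * suc (l₁ + l₂)
  budget₂ a b c l₁ l₂ p = begin
    a + (K * l₁ + (b + (K * l₂ + c)))       ≡⟨ shuffle a b c (K * l₁) (K * l₂) ⟩
    (a + b) + ((K * l₁ + K * l₂) + c)       ≡⟨ cong (λ k → (a + b) + (k + c)) (*-distribˡ-+ K l₁ l₂) ⟨
    (a + b) + (K * (l₁ + l₂) + c)           ≤⟨ budget₁ (a + b) c (l₁ + l₂) p ⟩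
    K * suc (l₁ + l₂)                       ∎
    where
    open ≤-Reasoning
    shuffle : ∀ a b c y z → a + (y + (b + (z + c))) ≡ (a + b) + ((y + z) + c)
    shuffle = solve-∀

  -- The weight of A in the potential pays for the recursive call.
  memoE : ∀ {A f q m p′ p} {η : Vec ℕ n} → ρ ⊢ ρ A ⇓ f → mem s 6 (toℕ A) ≡ 0 →
          Exec (Reach (ρ A)) translateBody (q ∷ []) s (K * len (ρ A)) (K * #ops (ρ A))
               (λ r s′ → Rep s′ r f × mem s′ 4 0 ≡ p) →
          Exec (Reach (var A))
               (call translate (0F ∷ []) (write 6 4F 0F (write 4 5F 3F (ret 0F))))
               (q ∷ m ∷ p′ ∷ toℕ A ∷ 0 ∷ η) s 4 0 (λ r s′ → Rep s′ r f × mem s′ 4 0 ≡ p′)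
  memoE {s = s} {A} {f} {p′ = p′} d z E = record
    { run   = call (run E) (write (write ret))
    ; inv   = record
      { output = output (inv E)
      ; count  = count (inv E)
      ; wf     = wf (inv E)
      ; bottom = bottom (inv E)
      ; heap   = heap (inv E)
      ; inp    = inp (inv E)
      ; pos    = pos (inv E)
      ; memo   = memo′
      }
    ; ext   = ≼-trans (ext E) e
    ; frame = λ B ¬D → trans (update-other (λ A≡B → ¬D (A , here refl ,
                                subst (Star (_↝_ ρ) A) (toℕ-injective A≡B) ε)))
                             (frame E B λ q → ¬D (Reach-var q))
    -- The budget `K * len (ρ A)` granted to the call equals the drop in potential when its result
    -- is recorded, so it cancels.
    ; time≤ = s≤s (+-cancelˡ-≤ (K * len (ρ A)) _ _ (begin
        K * len (ρ A) + ((time E + 3) + Φ″)  ≡⟨ shuffle (K * len (ρ A)) (time E) Φ″ ⟩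
        3 + (time E + (K * len (ρ A) + Φ″))  ≡⟨ cong (λ φ → 3 + (time E + φ)) (drop _) ⟨
        3 + (time E + Φ′)                    ≤⟨ +-monoʳ-≤ 3 (time≤ E) ⟩
        3 + (K * len (ρ A) + Φ)              ≡⟨ x∙yz≈y∙xz 3 (K * len (ρ A)) Φ ⟩
        K * len (ρ A) + (3 + Φ)              ∎))
    ; size≤ = +-cancelˡ-≤ (K * #ops (ρ A)) _ _ (begin
        K * #ops (ρ A) + (Ψ″ + C)            ≡⟨ +-assoc (K * #ops (ρ A)) Ψ″ C ⟨
        K * #ops (ρ A) + Ψ″ + C              ≡⟨ cong (_+ C) (drop _) ⟨
        Ψ′ + C                               ≤⟨ size≤ E ⟩
        K * #ops (ρ A) + sizePotential s     ∎)
    ; post  = Rep-≼ e (proj₁ (post E)) , refl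
    }
    where
    open ≤-Reasoning
    is = prog (final E)
    M′ = mem (final E)
    r = value E
    M″ = (M′ [ 6 , toℕ A ]≔ r) [ 4 , 0 ]≔ p′
    Φ = timePotential s
    Φ′ = potential (λ A → K * len (ρ A)) M′
    Φ″ = potential (λ A → K * len (ρ A)) M″
    Ψ′ = potential (λ A → K * #ops (ρ A)) M′
    Ψ″ = potential (λ A → K * #ops (ρ A)) M″
    C = sum (map cost is)
    e : final E ≼ is , M″
    e = record { grows = grows (≼-refl {final E}); used = ≤-refl; keeps = λ _ _ → refl , refl , refl }
    shuffle : ∀ w t φ → w + ((t + 3) + φ) ≡ 3 + (t + (w + φ))
    shuffle = solve-∀
    -- Without this the recorded result would read as missing and the potential would not drop.
    r≢0 : r ≢ 0
    r≢0 = Rep-≢0 (proj₁ (post E))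
      where
      Rep-≢0 : ∀ {s i f} → Rep s i f → i ≢ 0
      Rep-≢0 (closed c _)    refl with () ← Cell.lower c
      Rep-≢0 (open₁ c _ _ _) refl with () ← Cell.lower c
    z′ : M′ 6 (toℕ A) ≡ 0
    z′ = trans (frame E A (unreachable A)) z
    drop : ∀ w → potential w M′ ≡ w A + potential w M″
    drop w = total-update A
      (trans (cong (λ m → if m ≡ᵇ 0 then w A else 0) z′)
             (sym (trans (cong (w A +_) (trans (cong (λ m → if m ≡ᵇ 0 then w A else 0) (update-same (toℕ A)))
                                               (update-other r≢0)))
                         (+-identityʳ (w A)))))
      (λ B A≢B → cong (λ m → if m ≡ᵇ 0 then w B else 0)
                      (sym (update-other λ A≡B → A≢B (toℕ-injective A≡B))))
    memo′ : ∀ B → M″ 6 (toℕ B) ≡ 0 ⊎ (∀ f → ρ ⊢ var B ⇓ f → Rep (is , M″) (M″ 6 (toℕ B)) f)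
    memo′ B with toℕ A ≟ toℕ B
    ... | yes A≡B with refl ← toℕ-injective A≡B = inj₂ λ { g (var d′) →
      subst₂ (Rep (is , M″)) (sym (update-same (toℕ A))) (⇓-deterministic d d′)
             (Rep-≼ e (proj₁ (post E))) }
    ... | no A≢B with memo (inv E) B
    ...   | inj₁ z₁ = inj₁ (trans (update-other A≢B) z₁)
    ...   | inj₂ h  = inj₂ λ g d′ →
      subst (λ i → Rep (is , M″) i g) (sym (update-other A≢B)) (Rep-≼ e (h g d′))

  emptyE : Inv s → Exec D allocBody (0 ∷ 0 ∷ 0 ∷ []) s 8 0 λ v s′ → Rep s′ v []
  emptyE I = mapE (λ cell → closed {f = []} cell none) (allocE I)

  holeE : Inv s → Exec D allocBody (1 ∷ 0 ∷ 0 ∷ []) s 8 0 λ v s′ → Rep s′ v (param tt ∷ [])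
  holeE I = mapE (λ cell → open₁ {f = []} {g = []} cell hole none none) (allocE I)

  returnE : ∀ {m} {i j k : Fin m} {η s f p} → lookupᵛ η i ≡ 0 → lookupᵛ η j ≡ p →
            Inv s → Rep s (lookupᵛ η k) f →
            Exec D (write 4 i j (ret k)) η s 2 0 λ r s′ → Rep s′ r f × mem s′ 4 0 ≡ p
  returnE {i = i} {j} {k} {η} {s} e refl I r =
    moveE (retE (Inv-move (lookupᵛ η i) (lookupᵛ η j) I)
      (Rep-≼ (moved {s} (lookupᵛ η i) (lookupᵛ η j)) r ,
       cong (λ a → if a ≡ᵇ 0 then lookupᵛ η j else mem s 4 0) e))

  labelE : ∀ {m a} → Inv s → Cell (mem s) m (suc (num a)) 0 0 →
           Exec D allocBody (m ∷ 0 ∷ 0 ∷ []) s 8 0 λ v s′ → Rep s′ v (node a (param tt ∷ []) ∷ [])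
  labelE {D = D} I cell = postE E (open₁ {f = []} {g = []} (post E)
    (stem (Cell-≼ (ext E) cell) none (bot (bottom (inv E))) refl refl λ h →
      trans (cong fcns₁ (++-identityʳ h)) (sym (trans (++-identityʳ _) (ctx-⊥ h))))
    none none)
    where E = allocE {D = D} I

  joinE : ∀ {i j f g q q₁} {η : Vec ℕ 3} → Inv s → Rep s i f → Rep s j g → InF₀ f ⊎ InF₀ g →
          Exec D joinCode (4 ∷ q ∷ j ∷ q₁ ∷ i ∷ 3 ∷ 2 ∷ 1 ∷ 0 ∷ η) s 600 7
               λ r s′ → Rep s′ r (f ++ g) × mem s′ 4 0 ≡ q
  joinE {g = g} I (closed {f = f} c o) r₂ _ =
    weakenE (≤ᵇ⇒≤ _ _ tt) (≤ᵇ⇒≤ _ _ tt) $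
      readE (Cell.fst c) $ ifEqE refl $ readE (Cell.snd c) $
      callE (allocE I) λ I₁ e₁ cell →
      callE (graftE I₁ (open₁ {f = f} {g = []} cell hole (Opt-≼ e₁ o) none)
                    (middle-InF₁ f (param tt ∷ []) [] refl) (Rep-≼ e₁ r₂)) λ I₂ e₂ r →
      returnE refl refl I₂ (subst (Rep _ _) eq r)
    where
    eq : (embed f ++ param tt ∷ []) ⟪ g ⟫ ≡ embed f ++ g
    eq = trans (⟪⟫-middle f (param tt ∷ []) [] g)
               (cong (embed f ++_) (trans (++-identityʳ _) (++-identityʳ g)))
  joinE {f = f} I r₁@(open₁ c m o o′) (closed {f = g} c₂ o₂) _ =
    weakenE (≤ᵇ⇒≤ _ _ tt) (≤ᵇ⇒≤ _ _ tt) $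
      readE (Cell.fst c) $ ifNeqE (Stem-≢0 m) $ readE (Cell.snd c₂) $
      callE (allocE I) λ I₁ e₁ cell →
      callE (graftE I₁ (open₁ {f = []} {g = g} cell hole none (Opt-≼ e₁ o₂))
                    (middle-InF₁ [] (param tt ∷ []) g refl) (Rep-≼ e₁ r₁)) λ I₂ e₂ r →
      returnE refl refl I₂ (subst (Rep _ _) eq r)
    where
    eq : (param tt ∷ embed g) ⟪ f ⟫ ≡ f ++ embed g
    eq = cong (f ++_) (⟪⟫-ground (embed g) f (#x-embed g))
  joinE I (open₁ {f = f} {t = t} {g = g} _ m _ _) (open₁ _ _ _ _) (inj₁ z)
    with () ← trans (sym z) (middle-InF₁ f t g (Stem-InF₁ m))
  joinE I (open₁ _ _ _ _) (open₁ {f = f} {t = t} {g = g} _ m _ _) (inj₂ z)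
    with () ← trans (sym z) (middle-InF₁ f t g (Stem-InF₁ m))

  len-pair : ∀ e₁ e₂ → K * suc (len e₁ + len e₂) ≡
                       K * suc (length (encodeExpr num e₁ ++ encodeExpr num e₂))
  len-pair e₁ e₂ = cong (λ l → K * suc l) (sym (length-++ (encodeExpr num e₁)))

  end-pair : ∀ e₁ e₂ {p} → len e₂ + (len e₁ + suc p) ≡
                           suc (length (encodeExpr num e₁ ++ encodeExpr num e₂)) + p
  end-pair e₁ e₂ {p} = trans (shuffle (len e₁) (len e₂) p)
                             (cong (λ l → suc l + p) (sym (length-++ (encodeExpr num e₁))))
    where
    shuffle : ∀ a b p → b + (a + suc p) ≡ suc (a + b) + p
    shuffle = solve-∀

  module _ (positions : ∀ A → Holds input (offset ρ 2 A) (encodeExpr num (ρ A))) where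

    -- The recursion is on the evaluation derivation, which also descends through variables. A
    -- variable has no operations and thus no output budget of its own: its right-hand side is paid
    -- for by the potential.
    translateE : ∀ {e f p} → ρ ⊢ e ⇓ f → Holds input p (encodeExpr num e) → Inv s →
                 Exec (Reach e) translateBody (p ∷ []) s (K * len e) (K * #ops e)
                      λ r s′ → Rep s′ r f × mem s′ 4 0 ≡ len e + p
    translateE {s = s} (var {A} d) (w , a , _) I with mem s 6 (toℕ A) in m | memo I A
    ... | zero | _ =
      weakenE (budget₀ 1 (≤ᵇ⇒≤ _ _ tt)) z≤n $
        readE (trans (inp I _) w) $ incrE $ constE $ ifEqE refl $
        readE (trans (inp I _) a) $ incrE $ readE m $ ifEqE refl $
        readE (pos I A) $ memoE d m (translateE d (positions A) I)
    ... | suc r | inj₂ h =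
      weakenE (budget₀ 1 (≤ᵇ⇒≤ _ _ tt)) z≤n $
        readE (trans (inp I _) w) $ incrE $ constE $ ifEqE refl $
        readE (trans (inp I _) a) $ incrE $ readE m $ ifNeqE (λ ()) $
        returnE refl refl I (h _ (var d))
    translateE ε (w , _) I =
      weakenE (budget₀ 0 (≤ᵇ⇒≤ _ _ tt)) z≤n $
        readE (trans (inp I _) w) $ incrE $ constE $ ifNeqE (λ ()) $ constE $ ifEqE refl $
        callE (emptyE I) λ I₁ e₁ r → returnE refl refl I₁ r
    translateE x (w , _) I =
      weakenE (budget₀ 0 (≤ᵇ⇒≤ _ _ tt)) z≤n $
        readE (trans (inp I _) w) $ incrE $ constE $ ifNeqE (λ ()) $ constE $ ifNeqE (λ ()) $
        constE $ ifEqE refl $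
        callE (holeE I) λ I₁ e₁ r → returnE refl refl I₁ r
    translateE {p = p} (lab {a} {e} {f} d) (w , b , h) I =
      weakenE (≤-trans (budget₁ 14 _ (len e) (≤ᵇ⇒≤ _ _ tt)) (*-monoʳ-≤ K (n≤1+n _)))
              (budget₁ 0 _ (#ops e) (≤ᵇ⇒≤ _ _ tt)) $
        readE (trans (inp I _) w) $ incrE $ constE $ ifNeqE (λ ()) $ constE $ ifNeqE (λ ()) $
        constE $ ifNeqE (λ ()) $ constE $ ifEqE refl $
        readE (trans (inp I _) b) $ incrE $ incrE $
        callE (translateE d h I) λ I₁ e₁ (r , q) → readE q $
        callE (allocE I₁) λ I₂ e₂ cell →
        callE (labelE I₂ cell) λ I₃ e₃ g →
        callE (graftE I₃ g refl (Rep-≼ (≼-trans e₂ e₃) r)) λ I₄ e₄ v →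
        returnE refl (trans (+-suc (len e) (suc p)) (cong suc (+-suc (len e) p))) I₄
                (subst (λ g → Rep _ _ (node a g ∷ [])) (++-identityʳ f) v)
    translateE (hor {e₁} {e₂} d₁ d₂ c) (w , h) I with Holds-++⁻ (encodeExpr num e₁) h
    ... | h₁ , h₂ =
      weakenE (≤-trans (budget₂ 11 2 _ (len e₁) (len e₂) (≤ᵇ⇒≤ _ _ tt)) (≤-reflexive (len-pair e₁ e₂)))
              (budget₂ 0 0 _ (#ops e₁) (#ops e₂) (≤ᵇ⇒≤ _ _ tt)) $
        readE (trans (inp I _) w) $ incrE $ constE $ ifNeqE (λ ()) $ constE $ ifNeqE (λ ()) $
        constE $ ifNeqE (λ ()) $ constE $ ifNeqE (λ ()) $
        callE (frameE Reaches-++ˡ (translateE d₁ h₁ I)) λ I₁ e₁₁ (r₁ , q₁) → readE q₁ $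
        callE (frameE (Reaches-++ʳ (vars e₁)) (translateE d₂ h₂ I₁)) λ I₂ e₂₂ (r₂ , q₂) →
        readE (trans q₂ (end-pair e₁ e₂)) $ constE $ ifEqE refl $
        joinE I₂ (Rep-≼ e₂₂ r₁) r₂ c
    translateE (ver {e₁} {e₂} d₁ d₂ c) (w , h) I with Holds-++⁻ (encodeExpr num e₁) h
    ... | h₁ , h₂ =
      weakenE (≤-trans (budget₂ 11 2 _ (len e₁) (len e₂) (≤ᵇ⇒≤ _ _ tt)) (≤-reflexive (len-pair e₁ e₂)))
              (budget₂ 0 0 _ (#ops e₁) (#ops e₂) (≤ᵇ⇒≤ _ _ tt)) $
        readE (trans (inp I _) w) $ incrE $ constE $ ifNeqE (λ ()) $ constE $ ifNeqE (λ ()) $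
        constE $ ifNeqE (λ ()) $ constE $ ifNeqE (λ ()) $
        callE (frameE Reaches-++ˡ (translateE d₁ h₁ I)) λ I₁ e₁₁ (r₁ , q₁) → readE q₁ $
        callE (frameE (Reaches-++ʳ (vars e₁)) (translateE d₂ h₂ I₁)) λ I₂ e₂₂ (r₂ , q₂) →
        readE (trans q₂ (end-pair e₁ e₂)) $ constE $ ifNeqE (λ ()) $
        callE (graftE I₂ (Rep-≼ e₂₂ r₁) c r₂) λ I₃ e₃ r →
        returnE refl refl I₃ r

  -- Locating the right-hand sides

  skip-run : ∀ e p M → Holds (M 0) p (encodeExpr num e) →
             ∃[ t ] Run translator skipBody (p ∷ []) M t (len e + p) M × t ≤ 20 * len e
  skip-run₂ : ∀ e₁ e₂ p M → Holds (M 0) (suc p) (encodeExpr num e₁ ++ encodeExpr num e₂) →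
              let l = length (encodeExpr num e₁ ++ encodeExpr num e₂) in
              ∃[ t ] (∀ {m} {η : Vec ℕ m} {i} → lookupᵛ η i ≡ suc p →
                      Run translator (call skip (i ∷ []) (call skip (0F ∷ []) (ret 0F))) η M t (suc l + p) M) ×
                     t ≤ 3 + 20 * l
  skip-run (var A) p M (w , _) = 6 , read′ w (incr (const (ifEq refl (incr ret)))) , ≤ᵇ⇒≤ 6 40 tt
  skip-run ε p M (w , _) =
    7 , read′ w (incr (const (ifNeq (λ ()) (const (ifEq refl ret))))) , ≤ᵇ⇒≤ 7 20 tt
  skip-run x p M (w , _) =
    9 , read′ w (incr (const (ifNeq (λ ()) (const (ifNeq (λ ()) (const (ifEq refl ret))))))) , ≤ᵇ⇒≤ 9 20 tt
  skip-run (lab a e) p M (w , _ , h) with skip-run e (suc (suc p)) M h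
  ... | t , r , b =
    12 + (t + 1) ,
    read′ w (incr (const (ifNeq (λ ()) (const (ifNeq (λ ()) (const (ifNeq (λ ()) (const (ifEq refl
      (incr (call r (ret′ eq)))))))))))) ,
    bound
    where
    eq : len e + suc (suc p) ≡ suc (suc (len e)) + p
    eq = trans (+-suc (len e) (suc p)) (cong suc (+-suc (len e) p))
    bound : 12 + (t + 1) ≤ 20 * suc (suc (len e))
    bound = begin
      12 + (t + 1)           ≡⟨ cong (12 +_) (+-comm t 1) ⟩
      13 + t                 ≤⟨ +-mono-≤ (≤ᵇ⇒≤ 13 40 tt) b ⟩
      40 + 20 * len e        ≡⟨ *-distribˡ-+ 20 2 (len e) ⟨
      20 * suc (suc (len e)) ∎
      where open ≤-Reasoning
  skip-run (e₁ · e₂) p M (w , h) with skip-run₂ e₁ e₂ p M h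
  ... | t , r , b =
    10 + t ,
    read′ w (incr (const (ifNeq (λ ()) (const (ifNeq (λ ()) (const (ifNeq (λ ()) (const (ifNeq (λ ())
      (r refl)))))))))) ,
    ≤-trans (+-monoʳ-≤ 10 b) (≤-trans (+-monoˡ-≤ _ (≤ᵇ⇒≤ 13 20 tt)) (≤-reflexive (sym (*-suc 20 _))))
  skip-run (e₁ ⟨ e₂ ⟩) p M (w , h) with skip-run₂ e₁ e₂ p M h
  ... | t , r , b =
    10 + t ,
    read′ w (incr (const (ifNeq (λ ()) (const (ifNeq (λ ()) (const (ifNeq (λ ()) (const (ifNeq (λ ())
      (r refl)))))))))) ,
    ≤-trans (+-monoʳ-≤ 10 b) (≤-trans (+-monoˡ-≤ _ (≤ᵇ⇒≤ 13 20 tt)) (≤-reflexive (sym (*-suc 20 _))))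
  skip-run₂ e₁ e₂ p M h with Holds-++⁻ (encodeExpr num e₁) h
  ... | h₁ , h₂ with skip-run e₁ (suc p) M h₁ | skip-run e₂ (len e₁ + suc p) M h₂
  ... | t₁ , r₁ , b₁ | t₂ , r₂ , b₂ =
    suc (t₁ + suc (t₂ + 1)) ,
    (λ {m} {η} {i} e → call (subst (λ q → Run translator skipBody (q ∷ []) M t₁ (len e₁ + suc p) M) (sym e) r₁)
      (call r₂ (ret′ eq))) ,
    bound
    where
    eq : len e₂ + (len e₁ + suc p) ≡ suc (length (encodeExpr num e₁ ++ encodeExpr num e₂)) + p
    eq = trans (shuffle (len e₁) (len e₂) p) (cong (λ l → suc l + p) (sym (length-++ (encodeExpr num e₁))))
      where
      shuffle : ∀ a b p → b + (a + suc p) ≡ suc (a + b) + p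
      shuffle = solve-∀
    bound : suc (t₁ + suc (t₂ + 1)) ≤ 3 + 20 * length (encodeExpr num e₁ ++ encodeExpr num e₂)
    bound = begin
      suc (t₁ + suc (t₂ + 1))         ≡⟨ shuffle t₁ t₂ ⟩
      3 + (t₁ + t₂)                   ≤⟨ +-monoʳ-≤ 3 (+-mono-≤ b₁ b₂) ⟩
      3 + (20 * len e₁ + 20 * len e₂) ≡⟨ cong (3 +_) (*-distribˡ-+ 20 (len e₁) (len e₂)) ⟨
      3 + 20 * (len e₁ + len e₂)      ≡⟨ cong (λ l → 3 + 20 * l) (length-++ (encodeExpr num e₁)) ⟨
      3 + 20 * length (encodeExpr num e₁ ++ encodeExpr num e₂) ∎
      where
      open ≤-Reasoning
      shuffle : ∀ a b → suc (a + suc (b + 1)) ≡ 3 + (a + b)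
      shuffle = solve-∀

  listing : ∀ {m} → (Fin m → Expr Σ N) → List ℕ
  listing {m} g = concatMap (λ A → encodeExpr num (g A)) (allFin m)

  Holds-offset : ∀ {m} {h} (g : Fin m → Expr Σ N) p → Holds h p (listing g) →
                 ∀ A → Holds h (offset g p A) (encodeExpr num (g A))
  Holds-offset {h = h} g p H zero =
    proj₁ (Holds-++⁻ (encodeExpr num (g zero)) (subst (Holds h p) (concatMap-suc (λ A → encodeExpr num (g A))) H))
  Holds-offset {h = h} g p H (suc A) = Holds-offset (λ B → g (suc B)) _
    (proj₂ (Holds-++⁻ (encodeExpr num (g zero)) (subst (Holds h p) (concatMap-suc (λ A → encodeExpr num (g A))) H))) A

  record Located {m} (g : Fin m → Expr Σ N) (a p : ℕ) (M : Memory) : Set where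
    field
      time value : ℕ
      final      : Memory
      run        : Run translator locateBody (a ∷ N ∷ p ∷ []) M time value final
      time≤      : time ≤ 2 + 30 * length (listing g)
      keeps₀     : ∀ i → final 0 i ≡ M 0 i
      keeps₅     : ∀ i → i < a → final 5 i ≡ M 5 i
      keeps₆     : ∀ i → final 6 i ≡ M 6 i
      located    : ∀ A → final 5 (a + toℕ A) ≡ offset g p A

  locate-run : ∀ {m} (g : Fin m → Expr Σ N) a p M → a + m ≡ N → Holds (M 0) p (listing g) →
               Located g a p M
  locate-run {zero} g a p M e h = record
    { run = ifEq (trans (sym (+-identityʳ a)) e) ret; time≤ = ≤-refl
    ; keeps₀ = λ _ → refl; keeps₅ = λ _ _ → refl; keeps₆ = λ _ → refl; located = λ () }
  locate-run {suc m} g a p M e h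
    with Holds-++⁻ (encodeExpr num (g zero))
           (subst (Holds (M 0) p) (concatMap-suc (λ A → encodeExpr num (g A))) h)
  ... | h₁ , h₂ with skip-run (g zero) p (M [ 5 , a ]≔ p) h₁
                   | locate-run (λ A → g (suc A)) (suc a) (len (g zero) + p) (M [ 5 , a ]≔ p)
                                (trans (sym (+-suc a m)) e) h₂
  ... | t , r , b | L = record
    { run     = ifNeq (λ a≡N → m≢1+m+n a (trans a≡N (sym (trans (sym (+-suc a m)) e)))) (write (incr (call r (call (Located.run L) ret))))
    ; time≤   = bound
    ; keeps₀  = Located.keeps₀ L
    ; keeps₅  = λ i i<a → trans (Located.keeps₅ L i (m<n⇒m<1+n i<a))
                                (update-other λ a≡i → <-irrefl (sym a≡i) i<a)
    ; keeps₆  = Located.keeps₆ L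
    ; located = λ where
        zero    → trans (cong (Located.final L 5) (+-identityʳ a))
                        (trans (Located.keeps₅ L a ≤-refl) (update-same a))
        (suc A) → trans (cong (Located.final L 5) (+-suc a (toℕ A))) (Located.located L A)
    }
    where
    l = len (g zero)
    l′ = length (listing (λ A → g (suc A)))
    bound : 3 + suc (t + suc (Located.time L + 1)) ≤ 2 + 30 * length (listing g)
    bound = begin
      3 + suc (t + suc (Located.time L + 1)) ≡⟨ shuffle t (Located.time L) ⟩
      6 + (t + Located.time L)               ≤⟨ +-monoʳ-≤ 6 (+-mono-≤ b (Located.time≤ L)) ⟩
      6 + (20 * l + (2 + 30 * l′))           ≡⟨ shuffle′ (20 * l) (30 * l′) ⟩
      -- Each right-hand side has at least one word, and the ten extra steps per word cover the six
      -- steps of the loop.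
      2 + (6 + 20 * l + 30 * l′)             ≤⟨ +-monoʳ-≤ 2 (+-monoˡ-≤ _ (+-monoˡ-≤ _ six)) ⟩
      2 + (10 * l + 20 * l + 30 * l′)        ≡⟨ cong (λ k → 2 + (k + 30 * l′)) (*-distribʳ-+ l 10 20) ⟨
      2 + (30 * l + 30 * l′)                 ≡⟨ cong (2 +_) (*-distribˡ-+ 30 l l′) ⟨
      2 + 30 * (l + l′)                      ≡⟨ cong (λ k → 2 + 30 * k) (length-++ (encodeExpr num (g zero))) ⟨
      2 + 30 * length (encodeExpr num (g zero) ++ listing (λ A → g (suc A)))
        ≡⟨ cong (λ ws → 2 + 30 * length ws) (concatMap-suc (λ A → encodeExpr num (g A))) ⟨
      2 + 30 * length (listing g)            ∎
      where
      open ≤-Reasoning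
      six : 6 ≤ 10 * l
      six = ≤-trans (≤ᵇ⇒≤ 6 10 tt) (*-monoʳ-≤ 10 (len₊ num (g zero)))
      shuffle : ∀ a b → 3 + suc (a + suc (b + 1)) ≡ 6 + (a + b)
      shuffle = solve-∀
      shuffle′ : ∀ a b → 6 + (a + (2 + b)) ≡ 2 + (6 + a + b)
      shuffle′ = solve-∀

  -- The whole run and its bounds

  private
    M₀ = load (encode num F)
    H₀ = Holds-contents (encode num F)
    L = locate-run ρ 0 2 M₀ refl (proj₂ (proj₂ H₀))
    M₁ = Located.final L
    M₂ = putsᴹ (3 ∷ 0 ∷ 1 ∷ []) ((M₁ [ 2 , 0 ]≔ 2) [ 7 , 0 ]≔ 2) [ 3 , 0 ]≔ 1
    s₀ : State
    s₀ = bot ∷ [] , M₂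

    positions : ∀ A → Holds input (offset ρ 2 A) (encodeExpr num (ρ A))
    positions = Holds-offset ρ 2 (proj₂ (proj₂ H₀))

    I₀ : Inv s₀
    I₀ = record
      { output = refl , refl , refl , refl , tt
      ; count  = refl
      ; wf     = λ { zero _ → _ , bot here ; (suc k) (s≤s ()) }
      ; bottom = here
      ; heap   = ≤-refl
      ; inp    = Located.keeps₀ L
      ; pos    = Located.located L
      ; memo   = λ A → inj₁ (Located.keeps₆ L (toℕ A))
      }

    f = ⟦ F ⟧

    d : ρ ⊢ ρ S ⇓ embed f
    d with var d ← proj₂ ground = d

    -- The right-hand side of `S` is translated directly, without spending the credit of `S`. It is
    -- thus paid for in addition to the initial potential, whence the factor 2 in `2 * K`.
    E₁ = translateE positions d (positions S) I₀
    s₁ = final E₁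

    ground-context : ∀ {s i g} → Rep s i g → g ≡ embed f →
                     ∃[ l ] mem s 9 i ≡ l × Opt (prog s) l (ctx f)
    ground-context (closed {f = g} c o) e =
      -- `embed` is injective: `plug` with the empty forest is a left inverse.
      _ , Cell.snd c , subst (λ g → Opt _ _ (ctx g))
        (trans (sym (plug-embed g [])) (trans (cong (λ h → plug h []) e) (plug-embed f []))) o
    ground-context (open₁ {f = l} {t = t} {g = r} _ m _ _) e
      with () ← trans (sym (middle-InF₁ l t r (Stem-InF₁ m))) (trans (cong #x e) (#x-embed f))

    context = ground-context (proj₁ (post E₁)) refl

    E₂ = applyE {D = λ _ → ⊤} (inv E₁) (proj₂ (proj₂ context)) (bot (bottom (inv E₁)))
    s₂ = final E₂
    is = prog s₂
    v = value E₂

    v-val : Val is v (fcns₁ f)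
    v-val = subst (Val is v) (ctx-⊥ f) (post E₂)

  result : FSLP (Maybe Σ)
  result = grammar is (wf (inv E₂)) v-val

  result-TSLP : IsTSLP result
  result-TSLP = rules-TSLP is (wf (inv E₂))

  private
    encode-result : encode (withBottom num) result ≡ length is ∷ v ∷ code num is
    encode-result = cong₂ (λ v ws → length is ∷ v ∷ ws)
      (toℕ-fromℕ< (Val-< v-val)) (encode-rules is (wf (inv E₂)) num)

    pending≤ : ∀ w M → potential w M ≤ total w
    pending≤ w M = total-mono λ A → if≤ (M 6 (toℕ A)) (w A)
      where
      if≤ : ∀ m a → (if m ≡ᵇ 0 then a else 0) ≤ a
      if≤ zero    a = ≤-refl
      if≤ (suc m) a = z≤n

    M₃ = (mem s₂ [ 1 , 0 ]≔ mem s₂ 3 0) [ 1 , 1 ]≔ v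

    M₃-output : Holds (M₃ 1) 0 (length is ∷ v ∷ code num is)
    M₃-output = count (inv E₂) , refl ,
      Holds-cong (code num is) (λ { (suc (suc i)) _ _ → refl ; 0 () ; 1 (s≤s ()) }) (proj₂ (output (inv E₂)))

    L₀ = length (listing ρ)

    main-run : Run translator mainBody [] M₀
      (7 + (Located.time L + (26 + (time E₁ + (2 + (time E₂ + 5)))))) (2 + length (code num is)) M₃
    main-run = const (const (const (const (read (read (call (Located.run L)
      (write (write (call (put-run _ _) (call (put-run _ _) (call (put-run _ _)
      (write (read′ (pos I₀ S) (call (run E₁) (read′ (proj₁ (proj₂ context)) (call (run E₂)
      (read (write (write (read (ret′ (trans (proj₁ (output (inv E₂))) (+-comm (length (code num is)) 2)))))))))))))))))))))))

    len-total : total (λ A → len (ρ A)) ≡ L₀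
    len-total = sym (length-concatMap (λ A → encodeExpr num (ρ A)))

  time-bound : 7 + (Located.time L + (26 + (time E₁ + (2 + (time E₂ + 5))))) ≤
               (200 + 2 * K) * length (encode num F)
  time-bound = begin
    7 + (Located.time L + (26 + (time E₁ + (2 + (time E₂ + 5)))))
      ≡⟨ shuffle (Located.time L) (time E₁) (time E₂) ⟩
    40 + (Located.time L + (time E₁ + time E₂))
      ≤⟨ +-monoʳ-≤ 40 (+-mono-≤ (Located.time≤ L) evaluation) ⟩
    40 + ((2 + 30 * L₀) + ((K * L₀ + 50) + K * L₀))
      ≡⟨ shuffle′ K L₀ ⟩
    92 + (30 + 2 * K) * L₀
      ≤⟨ +-mono-≤ (≤-trans (≤ᵇ⇒≤ 92 200 tt) (≤-trans (m≤m+n 200 (2 * K)) (m≤m+n (200 + 2 * K) (200 + 2 * K))))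
                  (*-monoˡ-≤ L₀ (+-monoˡ-≤ (2 * K) (≤ᵇ⇒≤ 30 200 tt))) ⟩
    -- The two header words of the input absorb the additive constant.
    ((200 + 2 * K) + (200 + 2 * K)) + (200 + 2 * K) * L₀
      ≡⟨ shuffle″ (200 + 2 * K) L₀ ⟩
    (200 + 2 * K) * length (encode num F) ∎
    where
    open ≤-Reasoning
    evaluation : time E₁ + time E₂ ≤ (K * L₀ + 50) + K * L₀
    evaluation = ≤-trans (m≤m+n _ (timePotential s₂))
      (≤-trans (pay {time E₁} {time E₂} {K * len (ρ S)} {50} (timePotential s₀) (timePotential s₁) (timePotential s₂) (time≤ E₁) (time≤ E₂))
        (+-mono-≤ (+-monoˡ-≤ 50 (*-monoʳ-≤ K (≤-trans (term≤total (λ A → len (ρ A)) S) (≤-reflexive len-total))))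
          (≤-trans (pending≤ _ M₂) (≤-reflexive (trans (total-* K (λ A → len (ρ A))) (cong (K *_) len-total))))))
    shuffle : ∀ a b c → 7 + (a + (26 + (b + (2 + (c + 5))))) ≡ 40 + (a + (b + c))
    shuffle = solve-∀
    shuffle′ : ∀ k l → 40 + ((2 + 30 * l) + ((k * l + 50) + k * l)) ≡ 92 + (30 + 2 * k) * l
    shuffle′ = solve-∀
    shuffle″ : ∀ c l → (c + c) + c * l ≡ c * suc (suc l)
    shuffle″ = solve-∀

  computes : translator computes encode (withBottom num) result from encode num F within
               ((200 + 2 * K) * length (encode num F))
  computes = subst (λ ws → translator computes ws from encode num F within ((200 + 2 * K) * length (encode num F))) (sym encode-result)
    (_ , M₃ , time-bound , main-run , Holds-applyUpTo _ M₃-output)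

  private
    -- An additive constant can be absorbed only if `size F` is positive. A right-hand side may be a
    -- bare variable, but a finite derivation must end in an operation.
    size-positive : ∀ {e f} → ρ ⊢ e ⇓ f → 1 ≤ #ops e ⊎ 1 ≤ size F
    size-positive (var {A} d) with size-positive d
    ... | inj₁ p = inj₂ (≤-trans p (term≤total (λ A → #ops (ρ A)) A))
    ... | inj₂ p = inj₂ p
    size-positive ε           = inj₁ (s≤s z≤n)
    size-positive x           = inj₁ (s≤s z≤n)
    size-positive (lab _)     = inj₁ (s≤s z≤n)
    size-positive (hor _ _ _) = inj₁ (s≤s z≤n)
    size-positive (ver _ _ _) = inj₁ (s≤s z≤n)

    size≥1 : 1 ≤ size F
    size≥1 with size-positive d
    ... | inj₁ p = ≤-trans p (term≤total (λ A → #ops (ρ A)) S)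
    ... | inj₂ p = p

  size-bound : size result ≤ (200 + 2 * K) * size F
  size-bound = begin
    size result
      ≡⟨ sum-#ops-rules is (wf (inv E₂)) ⟩
    sum (map cost is)
      ≤⟨ m≤n+m _ _ ⟩
    sizePotential s₂
      ≤⟨ size≤ E₂ ⟩
    1 + sizePotential s₁
      ≤⟨ +-monoʳ-≤ 1 (size≤ E₁) ⟩
    1 + (K * #ops (ρ S) + sizePotential s₀)
      ≤⟨ +-monoʳ-≤ 1 (+-mono-≤ (*-monoʳ-≤ K (term≤total (λ A → #ops (ρ A)) S))
           (+-monoˡ-≤ 2 (≤-trans (pending≤ _ M₂) (≤-reflexive (total-* K (λ A → #ops (ρ A))))))) ⟩
    -- The 2 is the leaf ⊥, the 1 the final application of a context to it.
    1 + (K * size F + (K * size F + 2))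
      ≡⟨ shuffle K (size F) ⟩
    3 + 2 * K * size F
      ≤⟨ +-monoˡ-≤ (2 * K * size F) (*-mono-≤ {3} {200} (≤ᵇ⇒≤ 3 200 tt) size≥1) ⟩
    200 * size F + 2 * K * size F
      ≡⟨ *-distribʳ-+ (size F) 200 (2 * K) ⟨
    (200 + 2 * K) * size F ∎
    where
    open ≤-Reasoning
    shuffle : ∀ k n → 1 + (k * n + (k * n + 2)) ≡ 3 + 2 * k * n
    shuffle = solve-∀

proposition6 : ∀ (Σ : Set) (k : ℕ) (finite : Σ ↔ Fin k) →
    let # = λ (a : Σ) → toℕ (Inverse.to finite a) in
    ∃[ P ] ∃[ c ]
    ∀ (F : FSLP Σ) →
    ∃[ T ] IsTSLP T
    × ⟦ T ⟧ ≡ fcns ⟦ F ⟧ ∷ []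
    × size T ≤ c * size F
    × P computes encode (withBottom #) T from encode # F within (c * length (encode # F))
-- 1000 is a round number above the fixed cost of any node; the dearest, concatenation, is budgeted
-- at 616 steps. The value equation is `refl` because `grammar` stores the forest derived from its
-- start variable.
proposition6 Σ k finite = translator , 200 + 2 * 1000 , λ F →
  let open Translation (λ a → toℕ (Inverse.to finite a)) F 1000 ≤-refl in
  result , result-TSLP , refl , size-bound , computes
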